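{- For every odd $k\geq3$ and every even $d\geq2$ there exists a Cayley digraph of order $2k\left(\frac{d}{2}\right)^k$, degree $d$ and diameter at most $k$.
   Context: A Cayley digraph $Cay(\Gamma,X)$ of a group $\Gamma$ with respect to a generating set $X$ not containing the identity has vertex set $\Gamma$ and an arc from $u$ to $v$ iff $ux=v$ for some $x\in X$; its degree is $|X|$ and its order is $|\Gamma|$. The diameter is the maximum directed distance between vertices. -}

module Defs where

open import Data.Nat using (ℕ; zero; suc; _≤_)
open import Data.Fin using (Fin)
open import Data.List using (List; length)
open import Data.List.Membership.Propositional using (_∈_; _∉_)
open import Data.List.Relation.Unary.Unique.Propositional using (Unique)
open import Data.Product using (Σ; ∃; _×_)
open import Relation.Binary.PropositionalEquality using (_≡_)
open import Algebra.Structures using (IsGroup)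

record FiniteGroup (n : ℕ) : Set where
  field
    _·_     : Fin n → Fin n → Fin n
    e       : Fin n
    inv     : Fin n → Fin n
    isGroup : IsGroup _≡_ _·_ e inv

module _ {n : ℕ} (G : FiniteGroup n) where
  open FiniteGroup G

  data Generated (X : List (Fin n)) : Fin n → Set where
    gen-e   : Generated X e
    gen-x   : ∀ {x} → x ∈ X → Generated X x
    gen-mul : ∀ {a b} → Generated X a → Generated X b → Generated X (a · b)
    gen-inv : ∀ {a} → Generated X a → Generated X (inv a)

  -- X is a generating set of the group not containing the identity,
  -- given as a duplicate-free list (so |X| = length X)
  record CayleyGenSet (X : List (Fin n)) : Set where
    field
      unique     : Unique X
      noIdentity : e ∉ X
      generates  : ∀ g → Generated X g

  Arc : List (Fin n) → Fin n → Fin n → Set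
  Arc X u v = Σ (Fin n) λ x → (x ∈ X) × (u · x ≡ v)

  data Walk (X : List (Fin n)) : ℕ → Fin n → Fin n → Set where
    [] : ∀ {u} → Walk X zero u u
    _∷_ : ∀ {m u v w} → Arc X u v → Walk X m v w → Walk X (suc m) u w

  DistLe : List (Fin n) → Fin n → Fin n → ℕ → Set
  DistLe X u v k = Σ ℕ λ m → (m ≤ k) × Walk X m u v

  DiameterLe : List (Fin n) → ℕ → Set
  DiameterLe X k = ∀ u v → DistLe X u v k

{-# OPTIONS --safe #-}

-- Write k = 2q + 1 and m = d / 2.  The group is (ℤ/m)^(ℤ/k) ⋊ D_k, an element being a triple
-- (f , x , σ) with f : ℤ/k → ℤ/m, a position x on the k-cycle and a direction σ = ±1.  With
-- δ_v the indicator of v, the generators are a_c = (c δ₀ , 2 , +) and b_c = (c (δ₀ + δ₁) , -1 , -):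
-- multiplying (f , x , σ) by a_c adds c δ_x to f and moves x to x + 2σ, multiplying by b_c adds
-- c (δ_x + δ_{x+σ}) to f, moves x to x - σ and reverses σ.
-- For each of the 2k pairs (x , σ) we need a word in a, b of length k that leads from (0 , +) to
-- (x , σ) and whose k vectors δ_x (for a) and δ_x + δ_{x+σ} (for b) span (ℤ/m)^(ℤ/k): the labels c
-- can then be chosen so as to produce any f.  Regarding the b-vectors as edges on the cycle, the
-- vectors span once every vertex is visited by an a or is joined through edges to such a vertex.
-- Reversing the direction shifts the parity of the visited positions, so a run of a's and the
-- run back interleave, and abba visits or joins four consecutive vertices.  This suggests the words
--   a^j (abba)^r a^j l,   (abba)^r a^(j+1) b a^j l,   b a^j (abba)^r a^(j+1) l,   a^j b a^j (abba)^r a l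
-- with l either letter, whose end points exhaust all pairs (x , σ).

module Submission where

open import Defs
open import Algebra.Bundles using (Group)
open import Data.Bool using (if_then_else_; true; false)
open import Data.Fin as Fin using (Fin; toℕ; fromℕ<; combine; remQuot; funToFin; finToFun)
import Data.Fin.Properties as Fin
open import Data.Integer using (ℤ; +_; -[1+_]; _+_; _*_; -_; _/ℕ_)
open import Data.Integer.DivMod using (n%ℕd<d; a≡a%ℕn+[a/ℕn]*n)
import Data.Integer.Properties as ℤ
open import Data.Integer.Tactic.RingSolver using (solve-∀)
open import Data.List using (List; []; _∷_; _++_; replicate; length; tabulate)
open import Data.List.Membership.Propositional using (_∈_; _∉_)
open import Data.List.Membership.Propositional.Properties
  using (∈-tabulate⁺; ∈-tabulate⁻; ∈-++⁺ˡ; ∈-++⁺ʳ; ∈-++⁻)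
open import Data.List.Properties using (length-++; length-replicate; length-tabulate)
open import Data.List.Relation.Unary.Unique.Propositional using (Unique)
import Data.List.Relation.Unary.Unique.Propositional.Properties as Unique
open import Data.Nat as ℕ using (ℕ; zero; suc; NonZero)
import Data.Nat.DivMod as ℕ
import Data.Nat.Properties as ℕ
import Data.Nat.Tactic.RingSolver as ℕSolver
open import Data.Product using (Σ; _×_; _,_; proj₁; proj₂)
open import Data.Sign as Sign using (Sign)
import Data.Sign.Properties as Sign
open import Data.Sum using (inj₁; inj₂)
open import Function using (id; _∘_)
open import Function.Bundles using (Inverse)
open import Level using (0ℓ)
open import Relation.Binary.PropositionalEquality hiding (J)
open import Relation.Nullary using (¬_; yes; no; does; contradiction)

-- Congruences of integers

-- The quotient is stored as data: a congruence between explicit positions is proved by naming how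
-- many turns around the cycle separate them, which leaves a ring identity.
record Cong (n : ℕ) (x y : ℤ) : Set where
  constructor multiple
  field
    quot : ℤ
    eq   : x ≡ y + quot * + n

module _ {n : ℕ} where

  ≡⇒cong : ∀ {x y} → x ≡ y → Cong n x y
  ≡⇒cong {x} refl = multiple (+ 0) (lemma x (+ n))
    where
    lemma : ∀ x n → x ≡ x + + 0 * n
    lemma = solve-∀

  cong-refl : ∀ {x} → Cong n x x
  cong-refl = ≡⇒cong refl

  cong-sym : ∀ {x y} → Cong n x y → Cong n y x
  cong-sym {y = y} (multiple c eq) =
    multiple (- c) (trans (lemma y c (+ n)) (cong (_+ - c * + n) (sym eq)))
    where
    lemma : ∀ y c n → y ≡ (y + c * n) + - c * n
    lemma = solve-∀

  cong-trans : ∀ {x y z} → Cong n x y → Cong n y z → Cong n x z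
  cong-trans {z = z} (multiple c refl) (multiple d refl) = multiple (d + c) (lemma z c d (+ n))
    where
    lemma : ∀ z c d n → (z + d * n) + c * n ≡ z + (d + c) * n
    lemma = solve-∀

  cong-+ : ∀ {x y u v} → Cong n x y → Cong n u v → Cong n (x + u) (y + v)
  cong-+ {y = y} {v = v} (multiple c refl) (multiple d refl) = multiple (c + d) (lemma y v c d (+ n))
    where
    lemma : ∀ y v c d n → (y + c * n) + (v + d * n) ≡ (y + v) + (c + d) * n
    lemma = solve-∀

  cong-+ˡ : ∀ z {x y} → Cong n x y → Cong n (z + x) (z + y)
  cong-+ˡ z = cong-+ (cong-refl {x = z})

  cong-*ˡ : ∀ s {x y} → Cong n x y → Cong n (s * x) (s * y)
  cong-*ˡ s {y = y} (multiple c refl) = multiple (s * c) (lemma s y c (+ n))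
    where
    lemma : ∀ s y c n → s * (y + c * n) ≡ s * y + (s * c) * n
    lemma = solve-∀

  cong-neg : ∀ {x y} → Cong n x y → Cong n (- x) (- y)
  cong-neg {y = y} (multiple c refl) = multiple (- c) (lemma y c (+ n))
    where
    lemma : ∀ y c n → - (y + c * n) ≡ - y + - c * n
    lemma = solve-∀

-- A positive quotient would force `i` to be at least `n`. A negative one becomes positive in
-- `cong-sym p`, so the recursive call ends in one of the earlier clauses.
residues-unique : ∀ {n i j} → i ℕ.< n → j ℕ.< n → Cong n (+ i) (+ j) → i ≡ j
residues-unique {n} {i} {j} i<n j<n (multiple (+ zero) eq) =
  ℤ.+-injective (trans eq (ℤ.+-identityʳ (+ j)))
residues-unique {n} {i} {j} i<n j<n (multiple (+ suc c) eq) = contradiction i<n (ℕ.≤⇒≯ n≤i)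
  where
  i≡ : i ≡ j ℕ.+ suc c ℕ.* n
  i≡ = ℤ.+-injective (trans eq (cong (λ t → + j + t) (sym (ℤ.pos-* (suc c) n))))
  n≤i : n ℕ.≤ i
  n≤i = subst (n ℕ.≤_) (sym i≡) (ℕ.≤-trans (ℕ.m≤m+n n (c ℕ.* n)) (ℕ.m≤n+m _ j))
residues-unique i<n j<n p@(multiple -[1+ _ ] _) = sym (residues-unique j<n i<n (cong-sym p))

module _ {n : ℕ} .{{_ : NonZero n}} where

  residue : ℤ → Fin n
  residue x = fromℕ< (n%ℕd<d x n)

  toℤ : Fin n → ℤ
  toℤ i = + toℕ i

  toℤ-residue : ∀ x → Cong n (toℤ (residue x)) x
  toℤ-residue x rewrite Fin.toℕ-fromℕ< (n%ℕd<d x n) =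
    cong-sym (multiple (x /ℕ n) (a≡a%ℕn+[a/ℕn]*n x n))

  residue-cong : ∀ {x y} → Cong n x y → residue x ≡ residue y
  residue-cong {x} {y} x≈y = Fin.toℕ-injective (residues-unique
    (Fin.toℕ<n _) (Fin.toℕ<n _)
    (cong-trans (toℤ-residue x) (cong-trans x≈y (cong-sym (toℤ-residue y)))))

  residue-injective : ∀ {x y} → residue x ≡ residue y → Cong n x y
  residue-injective {x} {y} eq =
    cong-trans (cong-sym (toℤ-residue x)) (subst (λ i → Cong n (toℤ i) y) (sym eq) (toℤ-residue y))

  residue-toℤ : ∀ i → residue (toℤ i) ≡ i
  residue-toℤ i = Fin.toℕ-injective (residues-unique (Fin.toℕ<n _) (Fin.toℕ<n i) (toℤ-residue (toℤ i)))

-- Directions as signs, and the group (ℤ/m)^(ℤ/k) ⋊ D_k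

ε : Sign → ℤ
ε Sign.+ = + 1
ε Sign.- = -[1+ 0 ]

ε-* : ∀ σ τ → ε (σ Sign.* τ) ≡ ε σ * ε τ
ε-* Sign.+ Sign.+ = refl
ε-* Sign.+ Sign.- = refl
ε-* Sign.- Sign.+ = refl
ε-* Sign.- Sign.- = refl

ε² : ∀ σ → ε σ * ε σ ≡ + 1
ε² Sign.+ = refl
ε² Sign.- = refl

cancel-ε² : ∀ σ x → ε σ * (ε σ * x) ≡ x
cancel-ε² σ x = trans (sym (ℤ.*-assoc (ε σ) (ε σ) x)) (trans (cong (_* x) (ε² σ)) (ℤ.*-identityˡ x))

-- Functions ℤ/k → ℤ/m are modelled by k-periodic functions on ℤ with values taken modulo m, so
-- that the group laws are identities of integers.
module Wreath (k m : ℕ) where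

  record Elem : Set where
    constructor elem
    field
      base      : ℤ → ℤ
      base-cong : ∀ {x y} → Cong k x y → Cong m (base x) (base y)
      shift     : ℤ
      sign      : Sign

  open Elem public

  infix 4 _≈_
  record _≈_ (g h : Elem) : Set where
    constructor same
    field
      base≈  : ∀ z → Cong m (base g z) (base h z)
      shift≈ : Cong k (shift g) (shift h)
      sign≡  : sign g ≡ sign h

  open _≈_ public

  infixl 7 _∙_
  -- The left factor carries the affine map y ↦ x + ε σ y of the cycle. Its inverse is z ↦ ε σ (z -
  -- x), along which the function of the right factor is pulled back.
  _∙_ : Elem → Elem → Elem
  elem f f-cong x σ ∙ elem g g-cong y τ = elem
    (λ z → f z + g (ε σ * (z + - x)))
    (λ p → cong-+ (f-cong p) (g-cong (cong-*ˡ (ε σ) (cong-+ p cong-refl))))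
    (x + ε σ * y)
    (σ Sign.* τ)

  1# : Elem
  1# = elem (λ _ → + 0) (λ _ → cong-refl) (+ 0) Sign.+

  infix 8 _⁻¹
  _⁻¹ : Elem → Elem
  elem f f-cong x σ ⁻¹ = elem
    (λ z → - f (x + ε σ * z))
    (λ p → cong-neg (f-cong (cong-+ˡ x (cong-*ˡ (ε σ) p))))
    (- (ε σ * x))
    σ

  ≈-refl : ∀ {g} → g ≈ g
  ≈-refl = same (λ _ → cong-refl) cong-refl refl

  ≈-sym : ∀ {g h} → g ≈ h → h ≈ g
  ≈-sym (same p q r) = same (cong-sym ∘ p) (cong-sym q) (sym r)

  ≈-trans : ∀ {g h i} → g ≈ h → h ≈ i → g ≈ i
  ≈-trans (same p q r) (same p′ q′ r′) =
    same (λ z → cong-trans (p z) (p′ z)) (cong-trans q q′) (trans r r′)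

  ∙-cong : ∀ {g h i j} → g ≈ h → i ≈ j → g ∙ i ≈ h ∙ j
  ∙-cong {elem _ _ _ σ} {i = i} (same p q refl) (same p′ q′ refl) = same
    (λ z → cong-+ (p z) (cong-trans
      (base-cong i (cong-*ˡ (ε σ) (cong-+ˡ z (cong-neg q))))
      (p′ _)))
    (cong-+ q (cong-*ˡ (ε σ) q′))
    refl

  ⁻¹-cong : ∀ {g h} → g ≈ h → g ⁻¹ ≈ h ⁻¹
  ⁻¹-cong {g@(elem _ _ _ σ)} (same p q refl) = same
    (λ z → cong-neg (cong-trans
      (base-cong g (cong-+ q (cong-refl {x = ε σ * z})))
      (p _)))
    (cong-neg (cong-*ˡ (ε σ) q))
    refl

  ∙-assoc : ∀ g h i → (g ∙ h) ∙ i ≈ g ∙ (h ∙ i)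
  ∙-assoc (elem f _ x σ) (elem g _ y τ) (elem h h-cong w υ) = same
    (λ z → cong-trans
      (≡⇒cong (ℤ.+-assoc (f z) _ _))
      (cong-+ˡ (f z) (cong-+ˡ (g (ε σ * (z + - x))) (h-cong (≡⇒cong (argument z))))))
    (≡⇒cong (trans (cong (λ s → (x + ε σ * y) + s * w) (ε-* σ τ)) (shift-assoc x y w (ε σ) (ε τ))))
    (Sign.*-assoc σ τ υ)
    where
    -- The ring solver treats the sign as an indeterminate `s` and cannot use s² = 1, so a factor
    -- `s * (s * y)` is left for `cancel-ε²`.
    expand : ∀ z x y s t → (s * t) * (z + - (x + s * y)) ≡ t * (s * (z + - x) + - (s * (s * y)))
    expand = solve-∀
    argument : ∀ z → ε (σ Sign.* τ) * (z + - (x + ε σ * y)) ≡ ε τ * (ε σ * (z + - x) + - y)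
    argument z = begin
      ε (σ Sign.* τ) * (z + - (x + ε σ * y))              ≡⟨ cong (_* _) (ε-* σ τ) ⟩
      (ε σ * ε τ) * (z + - (x + ε σ * y))                 ≡⟨ expand z x y (ε σ) (ε τ) ⟩
      ε τ * (ε σ * (z + - x) + - (ε σ * (ε σ * y)))       ≡⟨ cong (λ u → ε τ * (ε σ * (z + - x) + - u)) (cancel-ε² σ y) ⟩
      ε τ * (ε σ * (z + - x) + - y)                       ∎
      where open ≡-Reasoning
    shift-assoc : ∀ x y w s t → (x + s * y) + (s * t) * w ≡ x + s * (y + t * w)
    shift-assoc = solve-∀

  ∙-identityˡ : ∀ g → 1# ∙ g ≈ g
  ∙-identityˡ (elem f f-cong x σ) = same
    (λ z → cong-trans (≡⇒cong (ℤ.+-identityˡ _)) (f-cong (≡⇒cong (argument z))))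
    (≡⇒cong (shift-id x))
    refl
    where
    argument : ∀ z → + 1 * (z + - + 0) ≡ z
    argument = solve-∀
    shift-id : ∀ x → + 0 + + 1 * x ≡ x
    shift-id = solve-∀

  ∙-identityʳ : ∀ g → g ∙ 1# ≈ g
  ∙-identityʳ (elem f _ x σ) = same
    (λ z → ≡⇒cong (ℤ.+-identityʳ (f z)))
    (≡⇒cong (shift-id x (ε σ)))
    (Sign.*-identityʳ σ)
    where
    shift-id : ∀ x s → x + s * + 0 ≡ x
    shift-id = solve-∀

  ∙-inverseˡ : ∀ g → g ⁻¹ ∙ g ≈ 1#
  ∙-inverseˡ (elem f f-cong x σ) = same
    (λ z → cong-trans
      (cong-+ˡ (- f (x + ε σ * z)) (f-cong (≡⇒cong (argument z))))
      (≡⇒cong (ℤ.+-inverseˡ (f (x + ε σ * z)))))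
    (≡⇒cong (ℤ.+-inverseˡ (ε σ * x)))
    (Sign.s*s≡+ σ)
    where
    expand : ∀ z x s → s * (z + - - (s * x)) ≡ s * (s * x) + s * z
    expand = solve-∀
    argument : ∀ z → ε σ * (z + - - (ε σ * x)) ≡ x + ε σ * z
    argument z = trans (expand z x (ε σ)) (cong (_+ ε σ * z) (cancel-ε² σ x))

  ∙-inverseʳ : ∀ g → g ∙ g ⁻¹ ≈ 1#
  ∙-inverseʳ (elem f f-cong x σ) = same
    (λ z → cong-trans
      (cong-+ˡ (f z) (cong-neg (f-cong (≡⇒cong (argument z)))))
      (≡⇒cong (ℤ.+-inverseʳ (f z))))
    (≡⇒cong (trans (expand x (ε σ)) (trans (cong (λ u → x + - u) (cancel-ε² σ x)) (ℤ.+-inverseʳ x))))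
    (Sign.s*s≡+ σ)
    where
    recentre : ∀ x z → x + (z + - x) ≡ z
    recentre = solve-∀
    argument : ∀ z → x + ε σ * (ε σ * (z + - x)) ≡ z
    argument z = trans (cong (λ u → x + u) (cancel-ε² σ (z + - x))) (recentre x z)
    expand : ∀ x s → x + s * - (s * x) ≡ x + - (s * (s * x))
    expand = solve-∀

  group : Group 0ℓ 0ℓ
  group = record
    { Carrier = Elem
    ; _≈_     = _≈_
    ; _∙_     = _∙_
    ; ε       = 1#
    ; _⁻¹     = _⁻¹
    ; isGroup = record
      { isMonoid = record
        { isSemigroup = record
          { isMagma = record
            { isEquivalence = record { refl = ≈-refl ; sym = ≈-sym ; trans = ≈-trans }
            ; ∙-cong        = ∙-cong
            }
          ; assoc = ∙-assoc
          }
        ; identity = ∙-identityˡ , ∙-identityʳ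
        }
      ; inverse = ∙-inverseˡ , ∙-inverseʳ
      ; ⁻¹-cong = ⁻¹-cong
      }
    }

-- Words and their end points

data Letter : Set where
  a b : Letter

State : Set
State = ℤ × Sign

step : Letter → State → State
step a (x , σ) = x + ε σ * + 2 , σ
step b (x , σ) = x + ε σ * -[1+ 0 ] , σ Sign.* Sign.-

end : List Letter → State → State
end []      s = s
end (l ∷ w) s = end w (step l s)

end-++ : ∀ v w s → end (v ++ w) s ≡ end w (end v s)
end-++ []      w s = refl
end-++ (l ∷ v) w s = end-++ v w (step l s)

aⁿ : ℕ → List Letter
aⁿ n = replicate n a

abbaⁿ : ℕ → List Letter
abbaⁿ zero    = []
abbaⁿ (suc r) = a ∷ b ∷ b ∷ a ∷ abbaⁿ r

end-aⁿ : ∀ n x σ → end (aⁿ n) (x , σ) ≡ (x + + n * (ε σ * + 2) , σ)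
end-aⁿ zero x σ = cong (_, σ) (lemma x (ε σ))
  where
  lemma : ∀ x s → x ≡ x + + 0 * (s * + 2)
  lemma = solve-∀
end-aⁿ (suc n) x σ = trans (end-aⁿ n _ σ) (cong (_, σ) (lemma x (+ n) (ε σ)))
  where
  lemma : ∀ x n s → (x + s * + 2) + n * (s * + 2) ≡ x + (+ 1 + n) * (s * + 2)
  lemma = solve-∀

flip² : ∀ σ → (σ Sign.* Sign.-) Sign.* Sign.- ≡ σ
flip² Sign.+ = refl
flip² Sign.- = refl

ε-flip : ∀ σ → ε (σ Sign.* Sign.-) ≡ - ε σ
ε-flip Sign.+ = refl
ε-flip Sign.- = refl

-- The first b reverses the direction, so the second one moves back. Hence abba advances like aa,
-- while its two b's supply two extra edges.
step-bb : ∀ x σ → step b (step b (x , σ)) ≡ (x , σ)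
step-bb x σ = cong₂ _,_
  (trans (cong (λ s → (x + ε σ * -[1+ 0 ]) + s * -[1+ 0 ]) (ε-flip σ)) (lemma x (ε σ)))
  (flip² σ)
  where
  lemma : ∀ x s → (x + s * -[1+ 0 ]) + - s * -[1+ 0 ] ≡ x
  lemma = solve-∀

step-abba : ∀ x σ → end (a ∷ b ∷ b ∷ a ∷ []) (x , σ) ≡ (x + ε σ * + 4 , σ)
step-abba x σ = trans (cong (step a) (step-bb (x + ε σ * + 2) σ)) (cong (_, σ) (lemma x (ε σ)))
  where
  lemma : ∀ x s → (x + s * + 2) + s * + 2 ≡ x + s * + 4
  lemma = solve-∀

end-abbaⁿ : ∀ r x σ → end (abbaⁿ r) (x , σ) ≡ (x + + r * (ε σ * + 4) , σ)
end-abbaⁿ zero x σ = cong (_, σ) (lemma x (ε σ))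
  where
  lemma : ∀ x s → x ≡ x + + 0 * (s * + 4)
  lemma = solve-∀
end-abbaⁿ (suc r) x σ = trans (cong (end (abbaⁿ r)) (step-abba x σ))
  (trans (end-abbaⁿ r _ σ) (cong (_, σ) (lemma x (+ r) (ε σ))))
  where
  lemma : ∀ x n s → (x + s * + 4) + n * (s * + 4) ≡ x + (+ 1 + n) * (s * + 4)
  lemma = solve-∀

-- Vertices covered by a word

module Progressions (k : ℕ) (Good : ℤ → Set)
                    (good-cong : ∀ {u v} → Good u → Cong k u v → Good v) where

  -- Good vertices are collected along arithmetic progressions: difference ±2 for runs of a's, ±1
  -- for blocks abba. The goal is a progression of difference 1 and length `k`.
  record Prog (δ x : ℤ) (n : ℕ) : Set where
    constructor prog
    field
      at : ∀ i → i ℕ.< n → Good (x + + i * δ)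

  open Prog public

  prog-[] : ∀ {δ x} → Prog δ x 0
  prog-[] = prog λ _ ()

  prog-cong : ∀ {δ x y n} → Cong k x y → Prog δ x n → Prog δ y n
  prog-cong x≈y p = prog λ i i<n → good-cong (at p i i<n) (cong-+ x≈y cong-refl)

  prog-∷ : ∀ {δ x n} → Good x → Prog δ (x + δ) n → Prog δ x (suc n)
  prog-∷ {δ} {x} {n} g p = prog λ where
      zero    _           → good-cong g (≡⇒cong (lemma₀ x δ))
      (suc i) (ℕ.s≤s i<n) → good-cong (at p i i<n) (≡⇒cong (lemma₁ x δ (+ i)))
    where
    lemma₀ : ∀ x δ → x ≡ x + + 0 * δ
    lemma₀ = solve-∀
    lemma₁ : ∀ x δ i → (x + δ) + i * δ ≡ x + (+ 1 + i) * δ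
    lemma₁ = solve-∀

  prog-head : ∀ {δ x n} → Prog δ x (suc n) → Good x
  prog-head {δ} {x} p = good-cong (at p 0 ℕ.z<s) (≡⇒cong (lemma x δ))
    where
    lemma : ∀ x δ → x + + 0 * δ ≡ x
    lemma = solve-∀

  prog-tail : ∀ {δ x n} → Prog δ x (suc n) → Prog δ (x + δ) n
  prog-tail {δ} {x} p = prog λ i i<n → good-cong (at p (suc i) (ℕ.s<s i<n)) (≡⇒cong (lemma x δ (+ i)))
    where
    lemma : ∀ x δ i → x + (+ 1 + i) * δ ≡ (x + δ) + i * δ
    lemma = solve-∀

  prog-init : ∀ {δ x n} → Prog δ x (suc n) → Prog δ x n
  prog-init p = prog λ i i<n → at p i (ℕ.m<n⇒m<1+n i<n)

  prog-++ : ∀ {δ x} n {n′} → Prog δ x n → Prog δ (x + + n * δ) n′ → Prog δ x (n ℕ.+ n′)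
  prog-++ {δ} {x} zero p p′ = prog-cong (≡⇒cong (lemma x δ)) p′
    where
    lemma : ∀ x δ → x + + 0 * δ ≡ x
    lemma = solve-∀
  prog-++ {δ} {x} (suc n) p p′ =
    prog-∷ (prog-head p) (prog-++ n (prog-tail p) (prog-cong (≡⇒cong (lemma x δ (+ n))) p′))
    where
    lemma : ∀ x δ n → x + (+ 1 + n) * δ ≡ (x + δ) + n * δ
    lemma = solve-∀

  prog-∷ʳ : ∀ {δ x n} → Prog δ x n → Good (x + + n * δ) → Prog δ x (suc n)
  prog-∷ʳ {n = n} p g = subst (Prog _ _) (ℕ.+-comm n 1) (prog-++ n p (prog-∷ g prog-[]))

  -- The new start is the last term x + (n - 1) δ, written without a predecessor so that it also
  -- makes sense for n = 0. This turns runs in direction - into ascending ones.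
  prog-reverse : ∀ {δ x n} → Prog δ x n → Prog (- δ) ((x + + n * δ) + - δ) n
  prog-reverse {n = zero} p = prog-[]
  prog-reverse {δ} {x} {suc n} p = prog-∷
    (good-cong (at p n (ℕ.n<1+n n)) (≡⇒cong (lemma x δ (+ n))))
    (prog-cong (≡⇒cong (lemma′ x δ (+ n))) (prog-reverse {δ} {x} {n} (prog-init p)))
    where
    lemma : ∀ x δ n → x + n * δ ≡ (x + (+ 1 + n) * δ) + - δ
    lemma = solve-∀
    lemma′ : ∀ x δ n → (x + n * δ) + - δ ≡ ((x + (+ 1 + n) * δ) + - δ) + - δ
    lemma′ = solve-∀

  -- Removing one term from each progression moves both starts by 2 and so preserves their distance
  -- 1.
  interleave : ∀ {x} n → Prog (+ 2) x n → Prog (+ 2) (x + + 1) n → Prog (+ 1) x (n ℕ.+ n)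
  interleave zero p p′ = prog-[]
  interleave {x} (suc n) p p′ = prog-∷ (prog-head p)
    (subst (Prog _ _) (sym (ℕ.+-suc n n)) (prog-∷ (prog-head p′)
      (prog-cong (≡⇒cong (lemma x)) (interleave n (prog-tail p)
        (prog-cong (≡⇒cong (lemma′ x)) (prog-tail p′))))))
    where
    lemma : ∀ x → x + + 2 ≡ (x + + 1) + + 1
    lemma = solve-∀
    lemma′ : ∀ x → (x + + 1) + + 2 ≡ (x + + 2) + + 1
    lemma′ = solve-∀

  -- The residue of v - x is less than `k` and serves as the index of a term congruent to `v`.
  prog-all : .{{_ : NonZero k}} → ∀ {x} → Prog (+ 1) x k → ∀ v → Good v
  prog-all {x} p v = good-cong (at p (toℕ r) (Fin.toℕ<n r))
    (cong-trans (cong-+ˡ x (cong-trans (≡⇒cong (ℤ.*-identityʳ _)) (toℤ-residue (v + - x))))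
                (≡⇒cong (recentre x v)))
    where
    r : Fin k
    r = residue (v + - x)
    recentre : ∀ x z → x + (z + - x) ≡ z
    recentre = solve-∀

-- Spans of the vectors contributed by a word

module Spans (k m : ℕ) .{{_ : NonZero k}} where

  single : ℤ → ℤ → ℤ → ℤ
  single v c z = if does (residue {k} z Fin.≟ residue v) then c else + 0

  single-⇔ : ∀ {v v′ z z′} c → (Cong k z v → Cong k z′ v′) → (Cong k z′ v′ → Cong k z v) →
             single v c z ≡ single v′ c z′
  single-⇔ {v} {v′} {z} {z′} c to from
    with residue {k} z Fin.≟ residue v | residue {k} z′ Fin.≟ residue v′
  ... | yes _ | yes _ = refl
  ... | no  _ | no  _ = refl
  ... | yes p | no ¬q = contradiction (residue-cong (to (residue-injective p))) ¬q
  ... | no ¬p | yes q = contradiction (residue-cong (from (residue-injective q))) ¬p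

  single-congˡ : ∀ {v v′} c z → Cong k v v′ → single v c z ≡ single v′ c z
  single-congˡ c z v≈ = single-⇔ {z = z} {z} c (λ p → cong-trans p v≈) (λ p → cong-trans p (cong-sym v≈))

  single-congʳ : ∀ v c {z z′} → Cong k z z′ → single v c z ≡ single v c z′
  single-congʳ v c z≈ = single-⇔ {v} {v} c (cong-trans (cong-sym z≈)) (cong-trans z≈)

  -- The map z ↦ ε σ (z - x) is inverse to u ↦ x + ε σ u, so pulling an indicator back along it
  -- moves its support to the image of `u`.
  single-affine : ∀ σ x u c z → single u c (ε σ * (z + - x)) ≡ single (x + ε σ * u) c z
  single-affine σ x u c z = single-⇔ c
    (λ p → cong-trans (≡⇒cong (sym (trans (cong (λ t → x + t) (cancel-ε² σ (z + - x))) (recentre x z))))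
             (cong-+ˡ x (cong-*ˡ (ε σ) p)))
    (λ p → cong-trans (cong-*ˡ (ε σ) (cong-+ p (cong-refl {x = - x})))
             (≡⇒cong (trans (cong (ε σ *_) (uncentre x (ε σ * u))) (cancel-ε² σ u))))
    where
    recentre : ∀ x z → x + (z + - x) ≡ z
    recentre = solve-∀
    uncentre : ∀ x y → (x + y) + - x ≡ y
    uncentre = solve-∀

  single-+ : ∀ v c d z → single v c z + single v d z ≡ single v (c + d) z
  single-+ v c d z with does (residue {k} z Fin.≟ residue v)
  ... | true  = refl
  ... | false = refl

  single-0 : ∀ v z → single v (+ 0) z ≡ + 0
  single-0 v z with does (residue {k} z Fin.≟ residue v)
  ... | true  = refl
  ... | false = refl

  single-≡ : ∀ v c {z} → Cong k z v → single v c z ≡ c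
  single-≡ v c {z} p with residue {k} z Fin.≟ residue v
  ... | yes _ = refl
  ... | no ¬q = contradiction (residue-cong p) ¬q

  single-≢ : ∀ v c {z} → ¬ Cong k z v → single v c z ≡ + 0
  single-≢ v c {z} ¬p with residue {k} z Fin.≟ residue v
  ... | yes q = contradiction (residue-injective q) ¬p
  ... | no  _ = refl

  vec : Letter → State → ℤ → ℤ → ℤ
  vec a (x , σ) c z = single x c z
  vec b (x , σ) c z = single x c z + single (x + ε σ) c z

  vec-+ : ∀ l s c d z → vec l s c z + vec l s d z ≡ vec l s (c + d) z
  vec-+ a (x , σ) c d z = single-+ x c d z
  vec-+ b (x , σ) c d z = trans
    (swap (single x c z) _ (single x d z) _)
    (cong₂ _+_ (single-+ x c d z) (single-+ (x + ε σ) c d z))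
    where
    swap : ∀ p q r s → (p + q) + (r + s) ≡ (p + r) + (q + s)
    swap = solve-∀

  vec-0 : ∀ l s z → vec l s (+ 0) z ≡ + 0
  vec-0 a (x , σ) z = single-0 x z
  vec-0 b (x , σ) z = cong₂ _+_ (single-0 x z) (single-0 (x + ε σ) z)

  infix 4 _≋_
  _≋_ : (ℤ → ℤ) → (ℤ → ℤ) → Set
  f ≋ g = ∀ z → Cong m (f z) (g z)

  -- A derivation holds one coefficient per letter. It is therefore a labelling of the word, from
  -- which a path in the group can be read off later.
  data Span : List Letter → State → (ℤ → ℤ) → Set where
    nil  : ∀ {s f} → f ≋ (λ _ → + 0) → Span [] s f
    cons : ∀ {l w s f} c g → Span w (step l s) g → f ≋ (λ z → vec l s c z + g z) → Span (l ∷ w) s f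

  span-≋ : ∀ {w s f g} → g ≋ f → Span w s f → Span w s g
  span-≋ p (nil q)        = nil (λ z → cong-trans (p z) (q z))
  span-≋ p (cons c h i q) = cons c h i (λ z → cong-trans (p z) (q z))

  span-0 : ∀ w {s} → Span w s (λ _ → + 0)
  span-0 []      = nil (λ _ → cong-refl)
  span-0 (l ∷ w) {s} = cons (+ 0) _ (span-0 w)
    (λ z → ≡⇒cong (sym (cong (_+ + 0) (vec-0 l s z))))

  span-+ : ∀ {w s f g} → Span w s f → Span w s g → Span w s (λ z → f z + g z)
  span-+ (nil p) (nil q) = nil (λ z → cong-+ (p z) (q z))
  span-+ {l ∷ w} {s} (cons c f′ i p) (cons d g′ j q) = cons (c + d) _ (span-+ i j)
    (λ z → cong-trans (cong-+ (p z) (q z))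
      (≡⇒cong (trans (swap (vec l s c z) (f′ z) (vec l s d z) (g′ z))
                     (cong (_+ (f′ z + g′ z)) (vec-+ l s c d z)))))
    where
    swap : ∀ p q r s → (p + q) + (r + s) ≡ (p + r) + (q + s)
    swap = solve-∀

  span-head : ∀ l w s c → Span (l ∷ w) s (vec l s c)
  span-head l w s c = cons c _ (span-0 w) (λ z → ≡⇒cong (sym (ℤ.+-identityʳ _)))

  span-tail : ∀ {l w s f} → Span w (step l s) f → Span (l ∷ w) s f
  span-tail {l} {s = s} {f} i = cons (+ 0) f i
    (λ z → ≡⇒cong (sym (trans (cong (_+ f z) (vec-0 l s z)) (ℤ.+-identityˡ (f z)))))

  span-++ʳ : ∀ v {w s f} → Span w (end v s) f → Span (v ++ w) s f
  span-++ʳ []      i = i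
  span-++ʳ (l ∷ v) i = span-tail (span-++ʳ v i)

  module Reachable (W : List Letter) (s₀ : State) where

    -- Quantifying over all labels provides every multiple of the indicator at once, so that closure
    -- under sums is enough for linear combinations.
    record Good (v : ℤ) : Set where
      constructor good
      field
        spanned : ∀ c → Span W s₀ (single v c)

    open Good public

    record Edge (u v : ℤ) : Set where
      constructor edge
      field
        spanned : ∀ c → Span W s₀ (λ z → single u c z + single v c z)

    -- Applied to a suffix `w` of `W` and the state in which it is read. As an inclusion of spans it
    -- starts from `id` and is passed along the word by `tail` and `drop`.
    Sub : List Letter → State → Set
    Sub w s = ∀ {f} → Span w s f → Span W s₀ f

    good-cong : ∀ {u v} → Good u → Cong k u v → Good v
    good-cong (good p) u≈v = good λ c →
      span-≋ (λ z → ≡⇒cong (single-congˡ c z (cong-sym u≈v))) (p c)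

    edge-sym : ∀ {u v} → Edge u v → Edge v u
    edge-sym {u} {v} (edge e) = edge λ c →
      span-≋ (λ z → ≡⇒cong (ℤ.+-comm (single v c z) (single u c z))) (e c)

    -- Subtract the multiple of the indicator of `v` from the same multiple of the edge vector.
    edge-good : ∀ {u v} → Edge u v → Good v → Good u
    edge-good {u} {v} (edge e) (good p) = good λ c →
      span-≋ (λ z → ≡⇒cong (eq c z)) (span-+ (e c) (p (- c)))
      where
      eq : ∀ c z → single u c z ≡ (single u c z + single v c z) + single v (- c) z
      eq c z = sym (begin
        (single u c z + single v c z) + single v (- c) z ≡⟨ ℤ.+-assoc (single u c z) _ _ ⟩
        single u c z + (single v c z + single v (- c) z) ≡⟨ cong (λ t → single u c z + t) (single-+ v c (- c) z) ⟩
        single u c z + single v (c + - c) z              ≡⟨ cong (λ t → single u c z + single v t z) (ℤ.+-inverseʳ c) ⟩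
        single u c z + single v (+ 0) z                  ≡⟨ cong (λ t → single u c z + t) (single-0 v z) ⟩
        single u c z + + 0                               ≡⟨ ℤ.+-identityʳ _ ⟩
        single u c z                                     ∎)
        where open ≡-Reasoning

    unit : ∀ {w x σ} → Sub (a ∷ w) (x , σ) → Good x
    unit {w} sub = good λ c → sub (span-head a w _ c)

    b-edge : ∀ {w x σ} → Sub (b ∷ w) (x , σ) → Edge x (x + ε σ)
    b-edge {w} sub = edge λ c → sub (span-head b w _ c)

    -- Treats both final letters at once: a visits `x` itself, b joins `x` to its neighbour in the
    -- current direction.
    last : ∀ l {x σ} → Sub (l ∷ []) (x , σ) → Good (x + ε σ) → Good x
    last a sub p = unit sub
    last b sub p = edge-good (b-edge sub) p

    tail : ∀ {l w s} → Sub (l ∷ w) s → Sub w (step l s)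
    tail sub i = sub (span-tail i)

    drop : ∀ v {w s s′} → end v s ≡ s′ → Sub (v ++ w) s → Sub w s′
    drop v refl sub i = sub (span-++ʳ v i)

    open Progressions k Good good-cong public

    run : ∀ n {w x σ} → Sub (aⁿ n ++ w) (x , σ) → Prog (ε σ * + 2) x n
    run zero    sub = prog-[]
    run (suc n) sub = prog-∷ (unit sub) (run n (tail sub))

    -- The first b attaches x + 3σ to x + 2σ, the second one attaches x + σ to x.
    run-abba : ∀ r {w x σ} → Sub (abbaⁿ r ++ w) (x , σ) → Prog (ε σ) x ((r ℕ.+ r) ℕ.+ (r ℕ.+ r))
    run-abba zero    sub = prog-[]
    run-abba (suc r) {w} {x} {σ} sub = subst (Prog (ε σ) x) (sym four)
      (prog-∷ g₀ (prog-∷ g₁ (prog-∷ (good-cong g₂ (≡⇒cong (two x (ε σ)))) (prog-∷ (good-cong g₃ (≡⇒cong (three x (ε σ))))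
        (prog-cong (≡⇒cong (next x (ε σ))) (run-abba r (drop (a ∷ b ∷ b ∷ a ∷ []) (step-abba x σ) sub)))))))
      where
      four : (suc r ℕ.+ suc r) ℕ.+ (suc r ℕ.+ suc r) ≡ 4 ℕ.+ ((r ℕ.+ r) ℕ.+ (r ℕ.+ r))
      four rewrite ℕ.+-suc r r | ℕ.+-suc (r ℕ.+ r) (suc (r ℕ.+ r)) | ℕ.+-suc (r ℕ.+ r) (r ℕ.+ r) = refl
      two : ∀ x s → x + s * + 2 ≡ (x + s) + s
      two = solve-∀
      three : ∀ x s → (x + s * + 2) + s ≡ ((x + s) + s) + s
      three = solve-∀
      next : ∀ x s → x + s * + 4 ≡ (((x + s) + s) + s) + s
      next = solve-∀
      g₀ : Good x
      g₀ = unit sub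
      g₂ : Good (x + ε σ * + 2)
      g₂ = unit (drop (a ∷ b ∷ b ∷ []) (step-bb (x + ε σ * + 2) σ) sub)
      g₃ : Good ((x + ε σ * + 2) + ε σ)
      g₃ = edge-good (edge-sym (b-edge (tail sub))) g₂
      one : ∀ x s → (x + s * + 2) + s * -[1+ 0 ] ≡ x + s
      one = solve-∀
      zero′ : ∀ x s → ((x + s * + 2) + s * -[1+ 0 ]) + - s ≡ x
      zero′ = solve-∀
      g₁ : Good (x + ε σ)
      g₁ = good-cong (edge-good (b-edge (tail (tail sub)))
             (good-cong g₀ (≡⇒cong (sym (trans (cong (λ t → ((x + ε σ * + 2) + ε σ * -[1+ 0 ]) + t) (ε-flip σ)) (zero′ x (ε σ)))))))
             (≡⇒cong (one x (ε σ)))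

-- The four families of words

-- With the two choices of the last letter l, the words A, B, C, D lead to the states (2w , +) and
-- (2w - 3 , -), where w = -2r, 2r + 1, 2r + 2, -(2r + 1) respectively.
wordA wordB wordC wordD : ℕ → ℕ → Letter → List Letter
wordA j r l = aⁿ j ++ abbaⁿ r ++ aⁿ j ++ l ∷ []
wordB j r l = abbaⁿ r ++ aⁿ (suc j) ++ (b ∷ []) ++ aⁿ j ++ l ∷ []
wordC j r l = (b ∷ []) ++ aⁿ j ++ abbaⁿ r ++ aⁿ (suc j) ++ l ∷ []
wordD j r l = aⁿ j ++ (b ∷ []) ++ aⁿ j ++ abbaⁿ r ++ (a ∷ []) ++ l ∷ []

origin : State
origin = + 0 , Sign.+

Spanning : ℕ → ℕ → List Letter → Set
Spanning m q W = ∀ v → Spans.Reachable.Good (suc (q ℕ.+ q)) m W origin v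

module _ (m j r : ℕ) (l : Letter) where

  private
    J = + j
    R = + r

  -- Here k = 2j + 4r + 1. The first run visits 0, 2, ..., 2j - 2, the abba block covers 2j, ..., 2j
  -- + 4r - 1, and the second run starts at 2j + 4r ≡ -1 and visits -1, 1, ..., 2j - 3. The last
  -- letter stands at 2j - 1 modulo `k` and completes the odd positions.
  spanningA : .{{NonZero (j ℕ.+ (r ℕ.+ r))}} → Spanning m (j ℕ.+ (r ℕ.+ r)) (wordA j r l)
  spanningA = prog-all {x = -[1+ 0 ]} (subst (Prog (+ 1) -[1+ 0 ]) (cong suc (size j r)) cover)
    where
    open Spans (suc ((j ℕ.+ (r ℕ.+ r)) ℕ.+ (j ℕ.+ (r ℕ.+ r)))) m
    open Reachable (wordA j r l) origin
    sub₁ : Sub (abbaⁿ r ++ aⁿ j ++ l ∷ []) (+ 0 + J * + 2 , Sign.+)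
    sub₁ = drop (aⁿ j) (end-aⁿ j (+ 0) Sign.+) id
    sub₂ : Sub (aⁿ j ++ l ∷ []) ((+ 0 + J * + 2) + R * + 4 , Sign.+)
    sub₂ = drop (abbaⁿ r) (end-abbaⁿ r (+ 0 + J * + 2) Sign.+) sub₁
    sub₃ : Sub (l ∷ []) (((+ 0 + J * + 2) + R * + 4) + J * + 2 , Sign.+)
    sub₃ = drop (aⁿ j) (end-aⁿ j ((+ 0 + J * + 2) + R * + 4) Sign.+) sub₂
    wrap₁ : ∀ J R → + 0 + J * + 2 ≡
            ((((+ 0 + J * + 2) + R * + 4) + J * + 2) + + 1) + -[1+ 0 ] * (+ 1 + ((J + (R + R)) + (J + (R + R))))
    wrap₁ = solve-∀
    -- The neighbour 2j required by `last` starts the abba block or, when r = 0, the second run,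
    -- which is then nonempty.
    corner : ∀ j r .{{_ : NonZero (j ℕ.+ (r ℕ.+ r))}} →
             Prog (+ 1) (+ 0 + + j * + 2) ((r ℕ.+ r) ℕ.+ (r ℕ.+ r)) →
             Prog (+ 2) ((+ 0 + + j * + 2) + + r * + 4) j → Good (+ 0 + + j * + 2)
    corner (suc j) zero    p p′ = good-cong (prog-head p′) (≡⇒cong (ℤ.+-identityʳ _))
    corner j       (suc r) p p′ = prog-head p
    final : Good (((+ 0 + J * + 2) + R * + 4) + J * + 2)
    final = last l sub₃ (good-cong (corner j r (run-abba r sub₁) (run j sub₂)) (multiple -[1+ 0 ] (wrap₁ J R)))
    wrap₂ : ∀ J R → (+ 0 + J * + 2) + R * + 4 ≡ -[1+ 0 ] + + 1 * (+ 1 + ((J + (R + R)) + (J + (R + R))))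
    wrap₂ = solve-∀
    odds : Prog (+ 2) -[1+ 0 ] (suc j)
    odds = prog-cong (multiple (+ 1) (wrap₂ J R)) (prog-∷ʳ (run j sub₂) final)
    double : ∀ J → + 0 + J * + 2 ≡ + 0 + (J + J) * + 1
    double = solve-∀
    cover : Prog (+ 1) -[1+ 0 ] (suc ((j ℕ.+ j) ℕ.+ ((r ℕ.+ r) ℕ.+ (r ℕ.+ r))))
    cover = prog-∷ (prog-head odds) (prog-++ (j ℕ.+ j) (interleave j (run j id) (prog-tail odds))
      (prog-cong (≡⇒cong (double J)) (run-abba r sub₁)))
    size : ∀ j r → (j ℕ.+ j) ℕ.+ ((r ℕ.+ r) ℕ.+ (r ℕ.+ r)) ≡ (j ℕ.+ (r ℕ.+ r)) ℕ.+ (j ℕ.+ (r ℕ.+ r))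
    size = ℕSolver.solve-∀

  -- Here k = 2j + 4r + 3. The block covers 0, ..., 4r - 1 and the run visits 4r, 4r + 2, ..., 4r +
  -- 2j. After the reversal the run back visits 4r + 2j + 1, ..., 4r + 3, and the last letter adds
  -- 4r + 1, next to 4r. The remaining vertex 4r + 2j + 2 is joined by the single b to k ≡ 0.
  spanningB : Spanning m (suc (j ℕ.+ (r ℕ.+ r))) (wordB j r l)
  spanningB = prog-all {x = + 0} (prog-∷ʳ cover (good-cong corner (≡⇒cong (double J R))))
    where
    q = suc (j ℕ.+ (r ℕ.+ r))
    open Spans (suc (q ℕ.+ q)) m
    open Reachable (wordB j r l) origin
    sub₁ : Sub (aⁿ (suc j) ++ (b ∷ []) ++ aⁿ j ++ l ∷ []) (+ 0 + R * + 4 , Sign.+)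
    sub₁ = drop (abbaⁿ r) (end-abbaⁿ r (+ 0) Sign.+) id
    x₂ = (+ 0 + R * + 4) + + suc j * + 2
    sub₂ : Sub ((b ∷ []) ++ aⁿ j ++ l ∷ []) (x₂ , Sign.+)
    sub₂ = drop (aⁿ (suc j)) (end-aⁿ (suc j) (+ 0 + R * + 4) Sign.+) sub₁
    sub₃ : Sub (aⁿ j ++ l ∷ []) (x₂ + -[1+ 0 ] , Sign.-)
    sub₃ = tail sub₂
    sub₄ : Sub (l ∷ []) ((x₂ + -[1+ 0 ]) + J * -[1+ 1 ] , Sign.-)
    sub₄ = drop (aⁿ j) (end-aⁿ j (x₂ + -[1+ 0 ]) Sign.-) sub₃
    turn : ∀ J R → + 0 + R * + 4 ≡ ((((+ 0 + R * + 4) + (+ 1 + J) * + 2) + -[1+ 0 ]) + J * -[1+ 1 ]) + -[1+ 0 ]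
    turn = solve-∀
    final : Good ((x₂ + -[1+ 0 ]) + J * -[1+ 1 ])
    final = last l sub₄ (good-cong (unit sub₁) (≡⇒cong (turn J R)))
    turn′ : ∀ J R → (((+ 0 + R * + 4) + (+ 1 + J) * + 2) + -[1+ 0 ]) + J * -[1+ 1 ] ≡ (+ 0 + R * + 4) + + 1
    turn′ = solve-∀
    odds : Prog (+ 2) ((+ 0 + R * + 4) + + 1) (suc j)
    odds = prog-cong (≡⇒cong (turn′ J R)) (prog-∷ final (prog-reverse (run j sub₃)))
    fourfold : ∀ R → + 0 + R * + 4 ≡ + 0 + ((R + R) + (R + R)) * + 1
    fourfold = solve-∀
    size : ∀ j r → ((r ℕ.+ r) ℕ.+ (r ℕ.+ r)) ℕ.+ (suc j ℕ.+ suc j) ≡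
            suc (j ℕ.+ (r ℕ.+ r)) ℕ.+ suc (j ℕ.+ (r ℕ.+ r))
    size = ℕSolver.solve-∀
    cover : Prog (+ 1) (+ 0) (q ℕ.+ q)
    cover = subst (Prog (+ 1) (+ 0)) (size j r)
      (prog-++ ((r ℕ.+ r) ℕ.+ (r ℕ.+ r)) (run-abba r id)
        (prog-cong (≡⇒cong (fourfold R)) (interleave (suc j) (run (suc j) sub₁) odds)))
    wrap : ∀ J R → + 0 ≡
            (((+ 0 + R * + 4) + (+ 1 + J) * + 2) + + 1) + -[1+ 0 ] * (+ 1 + ((+ 1 + (J + (R + R))) + (+ 1 + (J + (R + R)))))
    wrap = solve-∀
    corner : Good x₂
    corner = edge-good (b-edge sub₂) (good-cong (prog-head cover) (multiple -[1+ 0 ] (wrap J R)))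
    double : ∀ J R → (+ 0 + R * + 4) + (+ 1 + J) * + 2 ≡
            + 0 + ((+ 1 + (J + (R + R))) + (+ 1 + (J + (R + R)))) * + 1
    double = solve-∀

  -- Everything after the initial b runs downwards: -1, -3, ..., then the block from `x₂` = -1 - 2j,
  -- then a run from `x₃` = `x₂` - 4r, which modulo `k` visits 2, 0, ..., 2 - 2j. The last letter
  -- stands at `x₄` ≡ -2j, next to `x₂`. The initial b joins 1 to 0.
  spanningC : Spanning m (suc (j ℕ.+ (r ℕ.+ r))) (wordC j r l)
  spanningC = prog-all (subst (Prog (+ 1) x₃) (size j r) cover)
    where
    q = suc (j ℕ.+ (r ℕ.+ r))
    open Spans (suc (q ℕ.+ q)) m
    open Reachable (wordC j r l) origin
    4r = (r ℕ.+ r) ℕ.+ (r ℕ.+ r)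
    sub₁ : Sub (aⁿ j ++ abbaⁿ r ++ aⁿ (suc j) ++ l ∷ []) (-[1+ 0 ] , Sign.-)
    sub₁ = tail id
    x₂ = -[1+ 0 ] + J * -[1+ 1 ]
    sub₂ : Sub (abbaⁿ r ++ aⁿ (suc j) ++ l ∷ []) (x₂ , Sign.-)
    sub₂ = drop (aⁿ j) (end-aⁿ j -[1+ 0 ] Sign.-) sub₁
    x₃ = x₂ + R * -[1+ 3 ]
    sub₃ : Sub (aⁿ (suc j) ++ l ∷ []) (x₃ , Sign.-)
    sub₃ = drop (abbaⁿ r) (end-abbaⁿ r x₂ Sign.-) sub₂
    x₄ = x₃ + + suc j * -[1+ 1 ]
    sub₄ : Sub (l ∷ []) (x₄ , Sign.-)
    sub₄ = drop (aⁿ (suc j)) (end-aⁿ (suc j) x₃ Sign.-) sub₃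
    below : ∀ x R → (x + ((R + R) + (R + R)) * -[1+ 0 ]) + + 1 ≡ (x + R * -[1+ 3 ]) + + 1
    below = solve-∀
    lower : Prog (+ 1) x₃ (suc 4r)
    lower = prog-∷ (unit sub₃) (prog-cong (≡⇒cong (below x₂ R)) (prog-reverse (run-abba r sub₂)))
    wrap : ∀ J R → ((-[1+ 0 ] + J * -[1+ 1 ]) + R * -[1+ 3 ]) + ((R + R) + (R + R)) * + 1 ≡
                   ((((-[1+ 0 ] + J * -[1+ 1 ]) + R * -[1+ 3 ]) + (+ 1 + J) * -[1+ 1 ]) + -[1+ 0 ]) + + 1 * (+ 1 + ((+ 1 + (J + (R + R))) + (+ 1 + (J + (R + R)))))
    wrap = solve-∀
    final : Good x₄
    final = last l sub₄ (good-cong (at lower 4r (ℕ.n<1+n 4r)) (multiple (+ 1) (wrap J R)))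
    wrap′ : ∀ J R → ((-[1+ 0 ] + J * -[1+ 1 ]) + R * -[1+ 3 ]) + (+ 1 + J) * -[1+ 1 ] ≡
                    ((-[1+ 0 ] + J * -[1+ 1 ]) + + 1) + -[1+ 0 ] * (+ 1 + ((+ 1 + (J + (R + R))) + (+ 1 + (J + (R + R)))))
    wrap′ = solve-∀
    evens : Prog (+ 2) (x₂ + + 1) (suc j)
    -- The discarded top term is 2 ≡ `x₃`, which already begins `lower`.
    evens = prog-init (prog-cong (multiple -[1+ 0 ] (wrap′ J R)) (prog-∷ final (prog-reverse (run (suc j) sub₃))))
    top : ∀ J → ((-[1+ 0 ] + J * -[1+ 1 ]) + + 1) + J * + 2 ≡ + 0
    top = solve-∀
    top′ : ∀ J → + 1 ≡ ((-[1+ 0 ] + J * -[1+ 1 ]) + + 2) + J * + 2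
    top′ = solve-∀
    corner : Good (+ 1)
    corner = edge-good (edge-sym (b-edge id)) (good-cong (at evens j (ℕ.n<1+n j)) (≡⇒cong (top J)))
    next : ∀ x → x + + 2 ≡ (x + + 1) + + 1
    next = solve-∀
    odds : Prog (+ 2) ((x₂ + + 1) + + 1) (suc j)
    odds = prog-cong (≡⇒cong (next x₂)) (prog-∷ʳ (prog-reverse (run j sub₁)) (good-cong corner (≡⇒cong (top′ J))))
    meet : ∀ x R → x + + 1 ≡ (x + R * -[1+ 3 ]) + (+ 1 + ((R + R) + (R + R))) * + 1
    meet = solve-∀
    cover : Prog (+ 1) x₃ (suc 4r ℕ.+ (suc j ℕ.+ suc j))
    cover = prog-++ (suc 4r) lower (prog-cong (≡⇒cong (meet x₂ R)) (interleave (suc j) evens odds))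
    size : ∀ j r → suc ((r ℕ.+ r) ℕ.+ (r ℕ.+ r)) ℕ.+ (suc j ℕ.+ suc j) ≡
            suc (suc (j ℕ.+ (r ℕ.+ r)) ℕ.+ suc (j ℕ.+ (r ℕ.+ r)))
    size = ℕSolver.solve-∀

  -- The two runs visit 0, 2, ..., 2j - 2 and 2j - 1, ..., 1, the block covers -1, ..., -4r and the
  -- following a visits -4r - 1. The last letter stands at -4r - 3 ≡ 2j, next to 2j - 1, and the
  -- single b then joins 2j + 1 to 2j.
  spanningD : Spanning m (suc (j ℕ.+ (r ℕ.+ r))) (wordD j r l)
  spanningD = prog-all (subst (Prog (+ 1) x₄) (size j r)
    (prog-∷ʳ (prog-∷ʳ lower (good-cong corner (≡⇒cong (top J R)))) (good-cong corner′ (≡⇒cong (top′ J R)))))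
    where
    q = suc (j ℕ.+ (r ℕ.+ r))
    open Spans (suc (q ℕ.+ q)) m
    open Reachable (wordD j r l) origin
    4r = (r ℕ.+ r) ℕ.+ (r ℕ.+ r)
    x₁ = + 0 + J * + 2
    sub₁ : Sub ((b ∷ []) ++ aⁿ j ++ abbaⁿ r ++ (a ∷ []) ++ l ∷ []) (x₁ , Sign.+)
    sub₁ = drop (aⁿ j) (end-aⁿ j (+ 0) Sign.+) id
    x₂ = x₁ + -[1+ 0 ]
    sub₂ : Sub (aⁿ j ++ abbaⁿ r ++ (a ∷ []) ++ l ∷ []) (x₂ , Sign.-)
    sub₂ = tail sub₁
    x₃ = x₂ + J * -[1+ 1 ]
    sub₃ : Sub (abbaⁿ r ++ (a ∷ []) ++ l ∷ []) (x₃ , Sign.-)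
    sub₃ = drop (aⁿ j) (end-aⁿ j x₂ Sign.-) sub₂
    x₄ = x₃ + R * -[1+ 3 ]
    sub₄ : Sub ((a ∷ []) ++ l ∷ []) (x₄ , Sign.-)
    sub₄ = drop (abbaⁿ r) (end-abbaⁿ r x₃ Sign.-) sub₃
    sub₅ : Sub (l ∷ []) (x₄ + -[1+ 1 ] , Sign.-)
    sub₅ = tail sub₄
    start : ∀ J → (((+ 0 + J * + 2) + -[1+ 0 ]) + J * -[1+ 1 ]) + + 2 ≡ + 1
    start = solve-∀
    odds : Prog (+ 2) (+ 1) j
    odds = prog-cong (≡⇒cong (start J)) (prog-reverse (run j sub₂))
    below : ∀ x R → (x + ((R + R) + (R + R)) * -[1+ 0 ]) + + 1 ≡ (x + R * -[1+ 3 ]) + + 1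
    below = solve-∀
    meet : ∀ J R → + 0 ≡
            ((((+ 0 + J * + 2) + -[1+ 0 ]) + J * -[1+ 1 ]) + R * -[1+ 3 ]) + (+ 1 + ((R + R) + (R + R))) * + 1
    meet = solve-∀
    lower : Prog (+ 1) x₄ (suc 4r ℕ.+ (j ℕ.+ j))
    lower = prog-++ (suc 4r)
      (prog-∷ (unit sub₄) (prog-cong (≡⇒cong (below x₃ R)) (prog-reverse (run-abba r sub₃))))
      (prog-cong (≡⇒cong (meet J R)) (interleave j (run j id) odds))
    wrap : ∀ J R → ((((+ 0 + J * + 2) + -[1+ 0 ]) + J * -[1+ 1 ]) + R * -[1+ 3 ]) + (((R + R) + (R + R)) + (J + J)) * + 1 ≡
                   ((((((+ 0 + J * + 2) + -[1+ 0 ]) + J * -[1+ 1 ]) + R * -[1+ 3 ]) + -[1+ 1 ]) + -[1+ 0 ]) + + 1 * (+ 1 + ((+ 1 + (J + (R + R))) + (+ 1 + (J + (R + R)))))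
    wrap = solve-∀
    final : Good (x₄ + -[1+ 1 ])
    final = last l sub₅ (good-cong (at lower (4r ℕ.+ (j ℕ.+ j)) (ℕ.n<1+n _)) (multiple (+ 1) (wrap J R)))
    wrap′ : ∀ J R → ((((+ 0 + J * + 2) + -[1+ 0 ]) + J * -[1+ 1 ]) + R * -[1+ 3 ]) + -[1+ 1 ] ≡
                    (+ 0 + J * + 2) + -[1+ 0 ] * (+ 1 + ((+ 1 + (J + (R + R))) + (+ 1 + (J + (R + R)))))
    wrap′ = solve-∀
    corner : Good x₁
    corner = good-cong final (multiple -[1+ 0 ] (wrap′ J R))
    corner′ : Good (x₁ + + 1)
    corner′ = edge-good (edge-sym (b-edge sub₁)) corner
    top : ∀ J R → + 0 + J * + 2 ≡
            ((((+ 0 + J * + 2) + -[1+ 0 ]) + J * -[1+ 1 ]) + R * -[1+ 3 ]) + ((+ 1 + ((R + R) + (R + R))) + (J + J)) * + 1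
    top = solve-∀
    top′ : ∀ J R → (+ 0 + J * + 2) + + 1 ≡
            ((((+ 0 + J * + 2) + -[1+ 0 ]) + J * -[1+ 1 ]) + R * -[1+ 3 ]) + (+ 1 + ((+ 1 + ((R + R) + (R + R))) + (J + J))) * + 1
    top′ = solve-∀
    size : ∀ j r → suc (suc (suc ((r ℕ.+ r) ℕ.+ (r ℕ.+ r)) ℕ.+ (j ℕ.+ j))) ≡
            suc (suc (j ℕ.+ (r ℕ.+ r)) ℕ.+ suc (j ℕ.+ (r ℕ.+ r)))
    size = ℕSolver.solve-∀

-- Lengths and end points of the words

end-via : ∀ v {w s s′} → end v s ≡ s′ → end (v ++ w) s ≡ end w s′
end-via v {w} {s} refl = end-++ v w s

length-abbaⁿ : ∀ r → length (abbaⁿ r) ≡ (r ℕ.+ r) ℕ.+ (r ℕ.+ r)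
length-abbaⁿ zero = refl
length-abbaⁿ (suc r) = trans (cong (4 ℕ.+_) (length-abbaⁿ r)) (lemma r)
  where
  lemma : ∀ r → 4 ℕ.+ ((r ℕ.+ r) ℕ.+ (r ℕ.+ r)) ≡ (suc r ℕ.+ suc r) ℕ.+ (suc r ℕ.+ suc r)
  lemma = ℕSolver.solve-∀

length-aⁿ-++ : ∀ n {w N} → length w ≡ N → length (aⁿ n ++ w) ≡ n ℕ.+ N
length-aⁿ-++ n refl = trans (length-++ (aⁿ n)) (cong (ℕ._+ _) (length-replicate n))

length-abbaⁿ-++ : ∀ r {w N} → length w ≡ N → length (abbaⁿ r ++ w) ≡ ((r ℕ.+ r) ℕ.+ (r ℕ.+ r)) ℕ.+ N
length-abbaⁿ-++ r refl = trans (length-++ (abbaⁿ r)) (cong (ℕ._+ _) (length-abbaⁿ r))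

module _ (j r : ℕ) (l : Letter) where

  length-A : length (wordA j r l) ≡ suc ((j ℕ.+ (r ℕ.+ r)) ℕ.+ (j ℕ.+ (r ℕ.+ r)))
  length-A = trans (length-aⁿ-++ j (length-abbaⁿ-++ r (length-aⁿ-++ j refl))) (lemma j r)
    where
    lemma : ∀ j r → j ℕ.+ (((r ℕ.+ r) ℕ.+ (r ℕ.+ r)) ℕ.+ (j ℕ.+ 1)) ≡ suc ((j ℕ.+ (r ℕ.+ r)) ℕ.+ (j ℕ.+ (r ℕ.+ r)))
    lemma = ℕSolver.solve-∀

  length-B : length (wordB j r l) ≡ suc (suc (j ℕ.+ (r ℕ.+ r)) ℕ.+ suc (j ℕ.+ (r ℕ.+ r)))
  length-B = trans (length-abbaⁿ-++ r (length-aⁿ-++ (suc j) (cong suc (length-aⁿ-++ j refl)))) (lemma j r)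
    where
    lemma : ∀ j r → ((r ℕ.+ r) ℕ.+ (r ℕ.+ r)) ℕ.+ (suc j ℕ.+ suc (j ℕ.+ 1)) ≡
            suc (suc (j ℕ.+ (r ℕ.+ r)) ℕ.+ suc (j ℕ.+ (r ℕ.+ r)))
    lemma = ℕSolver.solve-∀

  length-C : length (wordC j r l) ≡ suc (suc (j ℕ.+ (r ℕ.+ r)) ℕ.+ suc (j ℕ.+ (r ℕ.+ r)))
  length-C = trans (cong suc (length-aⁿ-++ j (length-abbaⁿ-++ r (length-aⁿ-++ (suc j) refl)))) (lemma j r)
    where
    lemma : ∀ j r → suc (j ℕ.+ (((r ℕ.+ r) ℕ.+ (r ℕ.+ r)) ℕ.+ (suc j ℕ.+ 1))) ≡
            suc (suc (j ℕ.+ (r ℕ.+ r)) ℕ.+ suc (j ℕ.+ (r ℕ.+ r)))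
    lemma = ℕSolver.solve-∀

  length-D : length (wordD j r l) ≡ suc (suc (j ℕ.+ (r ℕ.+ r)) ℕ.+ suc (j ℕ.+ (r ℕ.+ r)))
  length-D = trans (length-aⁿ-++ j (cong suc (length-aⁿ-++ j (length-abbaⁿ-++ r refl)))) (lemma j r)
    where
    lemma : ∀ j r → j ℕ.+ suc (j ℕ.+ (((r ℕ.+ r) ℕ.+ (r ℕ.+ r)) ℕ.+ 2)) ≡
            suc (suc (j ℕ.+ (r ℕ.+ r)) ℕ.+ suc (j ℕ.+ (r ℕ.+ r)))
    lemma = ℕSolver.solve-∀

  private
    J = + j
    R = + r

  end-A : end (wordA j r l) origin ≡ step l (((+ 0 + J * + 2) + R * + 4) + J * + 2 , Sign.+)
  end-A = trans (end-via (aⁿ j) (end-aⁿ j _ _))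
    (trans (end-via (abbaⁿ r) (end-abbaⁿ r _ _)) (end-via (aⁿ j) (end-aⁿ j _ _)))

  end-B : end (wordB j r l) origin ≡
          step l ((((+ 0 + R * + 4) + + suc j * + 2) + -[1+ 0 ]) + J * -[1+ 1 ] , Sign.-)
  end-B = trans (end-via (abbaⁿ r) (end-abbaⁿ r _ _))
    (trans (end-via (aⁿ (suc j)) {s = + 0 + R * + 4 , Sign.+} (end-aⁿ (suc j) (+ 0 + R * + 4) _))
      (end-via (aⁿ j) (end-aⁿ j _ _)))

  end-C : end (wordC j r l) origin ≡
          step l (((-[1+ 0 ] + J * -[1+ 1 ]) + R * -[1+ 3 ]) + + suc j * -[1+ 1 ] , Sign.-)
  end-C = trans (end-via (aⁿ j) (end-aⁿ j _ _))
    (trans (end-via (abbaⁿ r) (end-abbaⁿ r _ _))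
      (end-via (aⁿ (suc j)) {s = x , Sign.-} (end-aⁿ (suc j) x _)))
    where
    x = (-[1+ 0 ] + J * -[1+ 1 ]) + R * -[1+ 3 ]

  end-D : end (wordD j r l) origin ≡
          step l (((((+ 0 + J * + 2) + -[1+ 0 ]) + J * -[1+ 1 ]) + R * -[1+ 3 ]) + -[1+ 1 ] , Sign.-)
  end-D = trans (end-via (aⁿ j) (end-aⁿ j _ _))
    (trans (end-via (aⁿ j) (end-aⁿ j _ _)) (end-via (abbaⁿ r) (end-abbaⁿ r _ _)))

-- A state (x , σ) is labelled by x + offset σ, which makes the labels 2w reached with l = a and with
-- l = b coincide.
offset : Sign → ℤ
offset Sign.+ = + 0
offset Sign.- = + 3

-- The final letter that produces direction σ when the direction before it is + (words A) or -
-- (words B, C, D).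
letter₊ letter₋ : Sign → Letter
letter₊ Sign.+ = a
letter₊ Sign.- = b
letter₋ Sign.+ = b
letter₋ Sign.- = a

-- A spanning word for every state

record Reach (m q : ℕ) (σ : Sign) (y : ℤ) : Set where
  field
    word      : List Letter
    length≡   : length word ≡ suc (q ℕ.+ q)
    spanning  : Spanning m q word
    position  : Cong (suc (q ℕ.+ q)) (proj₁ (end word origin) + offset σ) y
    direction : proj₂ (end word origin) ≡ σ

module _ (m j r : ℕ) where
  private
    J = + j
    R = + r

  reachA : .{{NonZero (j ℕ.+ (r ℕ.+ r))}} → ∀ σ → Reach m (j ℕ.+ (r ℕ.+ r)) σ (- + ((r ℕ.+ r) ℕ.+ (r ℕ.+ r)))
  reachA σ = record
    { word      = wordA j r (letter₊ σ)
    ; length≡   = length-A j r (letter₊ σ)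
    ; spanning  = spanningA m j r (letter₊ σ)
    ; position  = cong-trans (≡⇒cong (cong (λ s → proj₁ s + offset σ) (end-A j r (letter₊ σ)))) (pos σ)
    ; direction = trans (cong proj₂ (end-A j r (letter₊ σ))) (dir σ _)
    }
    where
    dir : ∀ σ x → proj₂ (step (letter₊ σ) (x , Sign.+)) ≡ σ
    dir Sign.+ _ = refl
    dir Sign.- _ = refl
    pos₊ : ∀ J R → ((((+ 0 + J * + 2) + R * + 4) + J * + 2) + + 2) + + 0 ≡
            - ((R + R) + (R + R)) + + 2 * (+ 1 + ((J + (R + R)) + (J + (R + R))))
    pos₊ = solve-∀
    pos₋ : ∀ J R → ((((+ 0 + J * + 2) + R * + 4) + J * + 2) + -[1+ 0 ]) + + 3 ≡
            - ((R + R) + (R + R)) + + 2 * (+ 1 + ((J + (R + R)) + (J + (R + R))))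
    pos₋ = solve-∀
    pos : ∀ σ → Cong _ (proj₁ (step (letter₊ σ) (((+ 0 + J * + 2) + R * + 4) + J * + 2 , Sign.+)) + offset σ) (- + ((r ℕ.+ r) ℕ.+ (r ℕ.+ r)))
    -- The label is 4j + 4r + 2 = 2k - 4r, hence two turns.
    pos Sign.+ = multiple (+ 2) (pos₊ J R)
    pos Sign.- = multiple (+ 2) (pos₋ J R)

  private
    dir : ∀ σ x → proj₂ (step (letter₋ σ) (x , Sign.-)) ≡ σ
    dir Sign.+ _ = refl
    dir Sign.- _ = refl

    pos₋ : ∀ σ x → proj₁ (step (letter₋ σ) (x , Sign.-)) + offset σ ≡ x + + 1
    pos₋ Sign.+ x = ℤ.+-identityʳ _
    pos₋ Sign.- x = lemma x
      where
      lemma : ∀ x → (x + -[1+ 1 ]) + + 3 ≡ x + + 1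
      lemma = solve-∀

  reachB : ∀ σ → Reach m (suc (j ℕ.+ (r ℕ.+ r))) σ (+ (suc (r ℕ.+ r) ℕ.+ suc (r ℕ.+ r)))
  reachB σ = record
    { word      = wordB j r (letter₋ σ)
    ; length≡   = length-B j r (letter₋ σ)
    ; spanning  = spanningB m j r (letter₋ σ)
    ; position  = ≡⇒cong (trans (cong (λ s → proj₁ s + offset σ) (end-B j r (letter₋ σ))) (trans (pos₋ σ _) (lemma J R)))
    ; direction = trans (cong proj₂ (end-B j r (letter₋ σ))) (dir σ _)
    }
    where
    lemma : ∀ J R → ((((+ 0 + R * + 4) + (+ 1 + J) * + 2) + -[1+ 0 ]) + J * -[1+ 1 ]) + + 1 ≡
            (+ 1 + (R + R)) + (+ 1 + (R + R))
    lemma = solve-∀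

  reachC : ∀ σ → Reach m (suc (j ℕ.+ (r ℕ.+ r))) σ (+ (suc (suc (r ℕ.+ r)) ℕ.+ suc (suc (r ℕ.+ r))))
  reachC σ = record
    { word      = wordC j r (letter₋ σ)
    ; length≡   = length-C j r (letter₋ σ)
    ; spanning  = spanningC m j r (letter₋ σ)
    ; position  = cong-trans (≡⇒cong (trans (cong (λ s → proj₁ s + offset σ) (end-C j r (letter₋ σ))) (pos₋ σ _))) (multiple -[1+ 1 ] (lemma J R))
    ; direction = trans (cong proj₂ (end-C j r (letter₋ σ))) (dir σ _)
    }
    where
    lemma : ∀ J R → (((-[1+ 0 ] + J * -[1+ 1 ]) + R * -[1+ 3 ]) + (+ 1 + J) * -[1+ 1 ]) + + 1 ≡
                    ((+ 2 + (R + R)) + (+ 2 + (R + R))) + -[1+ 1 ] * (+ 1 + ((+ 1 + (J + (R + R))) + (+ 1 + (J + (R + R)))))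
    lemma = solve-∀

  reachD : ∀ σ → Reach m (suc (j ℕ.+ (r ℕ.+ r))) σ (- + (suc (r ℕ.+ r) ℕ.+ suc (r ℕ.+ r)))
  reachD σ = record
    { word      = wordD j r (letter₋ σ)
    ; length≡   = length-D j r (letter₋ σ)
    ; spanning  = spanningD m j r (letter₋ σ)
    ; position  = ≡⇒cong (trans (cong (λ s → proj₁ s + offset σ) (end-D j r (letter₋ σ))) (trans (pos₋ σ _) (lemma J R)))
    ; direction = trans (cong proj₂ (end-D j r (letter₋ σ))) (dir σ _)
    }
    where
    lemma : ∀ J R → (((((+ 0 + J * + 2) + -[1+ 0 ]) + J * -[1+ 1 ]) + R * -[1+ 3 ]) + -[1+ 1 ]) + + 1 ≡
            - ((+ 1 + (R + R)) + (+ 1 + (R + R)))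
    lemma = solve-∀

data Parity : ℕ → Set where
  even : ∀ r → Parity (r ℕ.+ r)
  odd  : ∀ r → Parity (suc (r ℕ.+ r))

parity : ∀ n → Parity n
parity zero = even 0
parity (suc n) with parity n
... | even r = odd r
... | odd  r = subst Parity (cong suc (ℕ.+-suc r r)) (even (suc r))

module _ (m q : ℕ) .{{_ : NonZero q}} (σ : Sign) where

  -- Label -2n comes from A for even `n` and from D for odd `n`, with j = q - n.
  reach-neg : ∀ n → n ℕ.≤ q → Reach m q σ (- + (n ℕ.+ n))
  reach-neg n n≤q with parity n | ℕ.m≤n⇒∃[o]m+o≡n n≤q
  ... | even r | j , refl rewrite ℕ.+-comm (r ℕ.+ r) j = reachA m j r σ
  ... | odd  r | j , refl rewrite ℕ.+-comm (r ℕ.+ r) j = reachD m j r σ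

  reach-pos : ∀ n → n ℕ.≤ q → Reach m q σ (+ (n ℕ.+ n))
  reach-pos n n≤q with parity n
  reach-pos _ n≤q | odd r with ℕ.m≤n⇒∃[o]m+o≡n n≤q
  ... | j , refl rewrite ℕ.+-comm (r ℕ.+ r) j = reachB m j r σ
  -- C starts at label 4, so label 0 is taken from A.
  reach-pos _ n≤q | even zero = reach-neg 0 ℕ.z≤n
  -- For n = 2r + 2 word C has q = 2r + 1 + j, so `j` is the difference between `q` and n - 1.
  reach-pos _ n≤q | even (suc r) with ℕ.m≤n⇒∃[o]m+o≡n (ℕ.<⇒≤ n≤q)
  ... | j , eq rewrite ℕ.+-suc r r with eq
  ... | refl rewrite ℕ.+-comm (r ℕ.+ r) j = reachC m j r σ

  reach-cong : ∀ {x y} → Cong (suc (q ℕ.+ q)) x y → Reach m q σ x → Reach m q σ y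
  reach-cong x≈y ρ = record
    { word      = word
    ; length≡   = length≡
    ; spanning  = spanning
    ; position  = cong-trans position x≈y
    ; direction = direction
    }
    where open Reach ρ

  private
    halve : ∀ {i} → i ℕ.+ i ℕ.≤ q ℕ.+ q → i ℕ.≤ q
    halve 2i≤2q = ℕ.≮⇒≥ λ q<i → ℕ.≤⇒≯ 2i≤2q (ℕ.+-mono-< q<i q<i)

  -- Since `k` is odd, every residue is an even label: t = 2n + 1 is congruent to -2i, where n + i =
  -- q.
  reach-residue : ∀ t → t ℕ.≤ q ℕ.+ q → Reach m q σ (+ t)
  reach-residue t t≤2q with parity t
  ... | even n = reach-pos n (halve {n} t≤2q)
  ... | odd n with ℕ.m≤n⇒∃[o]m+o≡n (halve {n} (ℕ.<⇒≤ t≤2q))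
  ...   | i , refl = reach-cong (multiple -[1+ 0 ] (lemma (+ n) (+ i))) (reach-neg i (ℕ.m≤n+m i n))
    where
    lemma : ∀ n i → - (i + i) ≡ (+ 1 + (n + n)) + -[1+ 0 ] * (+ 1 + ((n + i) + (n + i)))
    lemma = solve-∀

  reach-all : ∀ y → Reach m q σ y
  reach-all y = reach-cong (toℤ-residue y) (reach-residue (toℕ t) (ℕ.s≤s⁻¹ (Fin.toℕ<n t)))
    where
    t : Fin (suc (q ℕ.+ q))
    t = residue y

-- The Cayley digraph

module Transport {n : ℕ} (𝔾 : Group 0ℓ 0ℓ) (iso : Inverse (Group.setoid 𝔾) (setoid (Fin n))) where
  open Group 𝔾 using (_≈_; _∙_; _⁻¹; ∙-cong; ⁻¹-cong; assoc; identityˡ; identityʳ; inverseˡ; inverseʳ)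
    renaming (ε to 1#; refl to ≈-refl; sym to ≈-sym; trans to ≈-trans)
  open Inverse iso using (to; from; to-cong; strictlyInverseˡ; strictlyInverseʳ)

  transport : FiniteGroup n
  transport = record
    { _·_     = λ x y → to (from x ∙ from y)
    ; e       = to 1#
    ; inv     = λ x → to (from x ⁻¹)
    ; isGroup = record
      { isMonoid = record
        { isSemigroup = record
          { isMagma = record { isEquivalence = isEquivalence ; ∙-cong = cong₂ (λ x y → to (from x ∙ from y)) }
          ; assoc   = λ x y z → to-cong (≈-trans (∙-cong (strictlyInverseʳ _) ≈-refl)
              (≈-trans (assoc (from x) (from y) (from z)) (∙-cong ≈-refl (≈-sym (strictlyInverseʳ _)))))
          }
        ; identity =
            (λ x → trans (to-cong (≈-trans (∙-cong (strictlyInverseʳ 1#) ≈-refl) (identityˡ (from x)))) (strictlyInverseˡ x))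
          , (λ x → trans (to-cong (≈-trans (∙-cong ≈-refl (strictlyInverseʳ 1#)) (identityʳ (from x)))) (strictlyInverseˡ x))
        }
      ; inverse =
          (λ x → to-cong (≈-trans (∙-cong (strictlyInverseʳ _) ≈-refl) (inverseˡ (from x))))
        , (λ x → to-cong (≈-trans (∙-cong ≈-refl (strictlyInverseʳ _)) (inverseʳ (from x))))
      ; ⁻¹-cong = cong (λ x → to (from x ⁻¹))
      }
    }

  to-∙ : ∀ g h → to (from (to g) ∙ from (to h)) ≡ to (g ∙ h)
  to-∙ g h = to-cong (∙-cong (strictlyInverseʳ g) (strictlyInverseʳ h))

  to-injective : ∀ {g h} → to g ≡ to h → g ≈ h
  to-injective {g} {h} eq = ≈-trans (≈-sym (strictlyInverseʳ g))
    (subst (λ j → from j ≈ h) (sym eq) (strictlyInverseʳ h))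

-- Makes generation a consequence of the diameter bound, applied to walks from the identity.
walk⇒generated : ∀ {n} (G : FiniteGroup n) {X i u v} → Walk G X i u v → Generated G X u → Generated G X v
walk⇒generated G []                   p = p
walk⇒generated G ((x , x∈X , refl) ∷ w) p = walk⇒generated G w (gen-mul p (gen-x x∈X))

-- Numbering the group elements

toBit : Sign → Fin 2
toBit Sign.+ = Fin.zero
toBit Sign.- = Fin.suc Fin.zero

fromBit : Fin 2 → Sign
fromBit Fin.zero    = Sign.+
fromBit (Fin.suc _) = Sign.-

toBit-fromBit : ∀ i → toBit (fromBit i) ≡ i
toBit-fromBit Fin.zero           = refl
toBit-fromBit (Fin.suc Fin.zero) = refl

fromBit-toBit : ∀ σ → fromBit (toBit σ) ≡ σ
fromBit-toBit Sign.+ = refl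
fromBit-toBit Sign.- = refl

funToFin-cong : ∀ {i n} {f g : Fin i → Fin n} → f ≗ g → funToFin f ≡ funToFin g
funToFin-cong {zero}  f≗g = refl
funToFin-cong {suc i} f≗g = cong₂ combine (f≗g Fin.zero) (funToFin-cong (f≗g ∘ Fin.suc))

module Encoding (k m : ℕ) .{{_ : NonZero k}} .{{_ : NonZero m}} where
  open Wreath k m

  values : Elem → Fin k → Fin m
  values g i = residue (base g (toℤ i))

  -- The nesting of `combine` follows the factors of the order: direction and position give 2k, the
  -- table of values gives m^k.
  encode : Elem → Fin (2 ℕ.* k ℕ.* m ℕ.^ k)
  encode g = combine {2 ℕ.* k} (combine (toBit (sign g)) (residue (shift g))) (funToFin (values g))

  tuple : (Fin 2 × Fin k) × (Fin k → Fin m) → Elem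
  tuple ((s , i) , f) = elem (λ z → toℤ (f (residue z)))
    (λ x≈y → ≡⇒cong (cong (toℤ ∘ f) (residue-cong x≈y))) (toℤ i) (fromBit s)

  split : Fin (2 ℕ.* k ℕ.* m ℕ.^ k) → (Fin 2 × Fin k) × (Fin k → Fin m)
  split j = remQuot {2} k (proj₁ (remQuot {2 ℕ.* k} (m ℕ.^ k) j)) , finToFun (proj₂ (remQuot {2 ℕ.* k} (m ℕ.^ k) j))

  decode : Fin (2 ℕ.* k ℕ.* m ℕ.^ k) → Elem
  decode = tuple ∘ split

  encode-cong : ∀ {g h} → g ≈ h → encode g ≡ encode h
  encode-cong (same p q r) = cong₂ (combine {2 ℕ.* k})
    (cong₂ (combine {2}) (cong toBit r) (residue-cong q))
    (funToFin-cong (λ i → residue-cong (p (toℤ i))))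

  encode-decode : ∀ j → encode (decode j) ≡ j
  encode-decode j = trans
    (cong₂ (combine {2 ℕ.* k})
      (trans (cong₂ (combine {2}) (toBit-fromBit (proj₁ head)) (residue-toℤ (proj₂ head))) (Fin.combine-remQuot {2} k _))
      (trans (funToFin-cong (λ i → trans (residue-toℤ _) (cong (finToFun (proj₂ pair)) (residue-toℤ i))))
             (Fin.funToFin-finToFin {k} {m} (proj₂ pair))))
    (Fin.combine-remQuot {2 ℕ.* k} (m ℕ.^ k) j)
    where
    pair : Fin (2 ℕ.* k) × Fin (m ℕ.^ k)
    pair = remQuot {2 ℕ.* k} (m ℕ.^ k) j
    head : Fin 2 × Fin k
    head = remQuot {2} k (proj₁ pair)

  decode-encode : ∀ g → decode (encode g) ≈ g
  decode-encode g = same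
    (λ z → cong-trans
      (≡⇒cong (cong toℤ (trans (cong (λ p → finToFun (proj₂ p) (residue z)) pair) (Fin.finToFun-funToFin (values g) (residue z)))))
      -- The table stores one period only; periodicity of `base g` recovers the value at `z`.
      (cong-trans (toℤ-residue (base g (toℤ (residue {k} z)))) (base-cong g (toℤ-residue z))))
    (cong-trans (≡⇒cong (cong (toℤ ∘ proj₂) head)) (toℤ-residue (shift g)))
    (trans (cong (fromBit ∘ proj₁) head) (fromBit-toBit (sign g)))
    where
    pair : remQuot {2 ℕ.* k} (m ℕ.^ k) (encode g) ≡
            (combine (toBit (sign g)) (residue (shift g)) , funToFin (values g))
    pair = Fin.remQuot-combine {2 ℕ.* k} _ _
    head : remQuot {2} k (proj₁ (remQuot {2 ℕ.* k} (m ℕ.^ k) (encode g))) ≡ (toBit (sign g) , residue (shift g))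
    head = trans (cong (remQuot {2} k ∘ proj₁) pair) (Fin.remQuot-combine {2} (toBit (sign g)) _)

  encoding : Inverse (Group.setoid group) (setoid (Fin (2 ℕ.* k ℕ.* m ℕ.^ k)))
  encoding = record
    { to        = encode
    ; from      = decode
    ; to-cong   = encode-cong
    ; from-cong = λ { refl → ≈-refl }
    ; inverse   = (λ {j} p → trans (encode-cong p) (encode-decode j)) , (λ { {g} refl → decode-encode g })
    }

-- Paths of length k between group elements

module Paths (q m : ℕ) .{{_ : NonZero q}} .{{_ : NonZero m}} where

  k : ℕ
  k = suc (q ℕ.+ q)

  open Spans k m
  open Wreath k m

  -- Partial sums of the expansion of a periodic function in indicators: they agree with `f` on 0,
  -- ..., n - 1 and vanish on n, ..., k - 1.
  partial : (ℤ → ℤ) → ℕ → ℤ → ℤ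
  partial f zero    z = + 0
  partial f (suc n) z = partial f n z + single (+ n) (f (+ n)) z

  single-off : ∀ {n t} c → n ℕ.< k → t ℕ.< k → t ≢ n → single (+ n) c (+ t) ≡ + 0
  single-off {n} c n<k t<k t≢n = single-≢ (+ n) c (λ p → t≢n (residues-unique t<k n<k p))

  partial-above : ∀ f n {t} → n ℕ.≤ t → t ℕ.< k → partial f n (+ t) ≡ + 0
  partial-above f zero    _   _   = refl
  partial-above f (suc n) n<t t<k = cong₂ _+_
    (partial-above f n (ℕ.<⇒≤ n<t) t<k)
    (single-off _ (ℕ.<-trans n<t t<k) t<k (ℕ.>⇒≢ n<t))

  partial-below : ∀ f n {t} → t ℕ.< n → n ℕ.≤ k → partial f n (+ t) ≡ f (+ t)
  partial-below f (suc n) {t} (ℕ.s≤s t≤n) n<k with ℕ.m≤n⇒m<n∨m≡n t≤n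
  ... | inj₁ t<n = trans
    (cong₂ _+_ (partial-below f n t<n (ℕ.<⇒≤ n<k)) (single-off _ n<k (ℕ.<-trans t<n n<k) (ℕ.<⇒≢ t<n)))
    (ℤ.+-identityʳ _)
  ... | inj₂ refl = trans
    (cong₂ _+_ (partial-above f n ℕ.≤-refl n<k) (single-≡ (+ n) (f (+ n)) cong-refl))
    (ℤ.+-identityˡ _)

  partial-cong : ∀ f n {x y} → Cong k x y → partial f n x ≡ partial f n y
  partial-cong f zero    x≈y = refl
  partial-cong f (suc n) x≈y = cong₂ _+_ (partial-cong f n x≈y) (single-congʳ (+ n) (f (+ n)) x≈y)

  spanning⇒span : ∀ {W} → Spanning m q W → ∀ g → Span W origin (base g)
  spanning⇒span {W} all g = span-≋ total (spans k)
    where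
    spans : ∀ n → Span W origin (partial (base g) n)
    spans zero    = span-0 W
    spans (suc n) = span-+ (spans n) (Reachable.Good.spanned (all (+ n)) (base g (+ n)))
    total : ∀ z → Cong m (base g z) (partial (base g) k z)
    total z = cong-trans (base-cong g (cong-sym (toℤ-residue z))) (≡⇒cong (sym (trans
      (partial-cong (base g) k (cong-sym (toℤ-residue z)))
      (partial-below (base g) k (Fin.toℕ<n (residue z)) ℕ.≤-refl))))

  vec-periodic : ∀ l s c {x y} → Cong k x y → vec l s c x ≡ vec l s c y
  vec-periodic a (x , σ) c p = single-congʳ x c p
  vec-periodic b (x , σ) c p = cong₂ _+_ (single-congʳ x c p) (single-congʳ (x + ε σ) c p)

  single-label : ∀ v {c d} z → Cong m c d → Cong m (single v c z) (single v d z)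
  single-label v z p with does (residue {k} z Fin.≟ residue v)
  ... | true  = p
  ... | false = cong-refl

  vec-label : ∀ l s {c d} z → Cong m c d → Cong m (vec l s c z) (vec l s d z)
  vec-label a (x , σ) z p = single-label x z p
  vec-label b (x , σ) z p = cong-+ (single-label x z p) (single-label (x + ε σ) z p)

  gen : Letter → ℤ → Elem
  gen l c = elem (vec l origin c) (≡⇒cong ∘ vec-periodic l origin c)
    (proj₁ (step l origin)) (proj₂ (step l origin))

  gen-cong : ∀ l {c d} → Cong m c d → gen l c ≈ gen l d
  gen-cong l p = same (λ z → vec-label l origin z p) cong-refl refl

  state : Elem → State
  state g = shift g , sign g

  state-gen : ∀ l c g → state (g ∙ gen l c) ≡ step l (state g)
  state-gen a c g = cong (shift g + ε (sign g) * + 2 ,_) (Sign.*-identityʳ (sign g))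
  state-gen b c g = refl

  -- Right multiplication by a generator acts as reading its letter: the vector taken at the origin
  -- is transported to the state of `g` by `single-affine`.
  base-gen : ∀ l c g z → base (g ∙ gen l c) z ≡ base g z + vec l (state g) c z
  base-gen l c g z = cong (λ t → base g z + t) (translate l)
    where
    x = shift g
    σ = sign g
    zeroth : single (+ 0) c (ε σ * (z + - x)) ≡ single x c z
    zeroth = trans (single-affine σ x (+ 0) c z)
      (single-congˡ c z (≡⇒cong (trans (cong (λ t → x + t) (ℤ.*-zeroʳ (ε σ))) (ℤ.+-identityʳ x))))
    first : single (+ 1) c (ε σ * (z + - x)) ≡ single (x + ε σ) c z
    first = trans (single-affine σ x (+ 1) c z)
      (single-congˡ c z (≡⇒cong (cong (λ t → x + t) (ℤ.*-identityʳ (ε σ)))))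
    translate : ∀ l → vec l origin c (ε σ * (z + - x)) ≡ vec l (state g) c z
    translate a = zeroth
    translate b = cong₂ _+_ zeroth first

  -- Walks before the passage to `Fin`, ending up to `≈` because the group laws hold only up to `≈`.
  data Path : ℕ → Elem → Elem → Set where
    done : ∀ {g h} → g ≈ h → Path 0 g h
    go   : ∀ {n g h} l c → Path n (g ∙ gen l c) h → Path (suc n) g h

  path-≈ : ∀ {n g g′ h h′} → g ≈ g′ → h ≈ h′ → Path n g h → Path n g′ h′
  path-≈ p q (done r)   = done (≈-trans (≈-sym p) (≈-trans r q))
  path-≈ p q (go l c r) = go l c (path-≈ (∙-cong p (≈-refl {gen l c})) q r)

  -- Left translation preserves arcs, so that only paths starting at the identity have to be
  -- constructed.
  path-∙ : ∀ {n h i} g → Path n h i → Path n (g ∙ h) (g ∙ i)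
  path-∙ g (done r)           = done (∙-cong ≈-refl r)
  path-∙ {h = h} g (go l c r) = go l c (path-≈ (≈-sym (∙-assoc g h (gen l c))) ≈-refl (path-∙ g r))

  -- The coefficients become the labels of the generators; `f` is the part of `base h` still missing
  -- from `base g`.
  span⇒path : ∀ {w s f g h} → Span w s f → s ≡ state g →
    (∀ z → Cong m (base g z + f z) (base h z)) →
    Cong k (proj₁ (end w s)) (shift h) → proj₂ (end w s) ≡ sign h → Path (length w) g h
  span⇒path {g = g} (nil f≈0) refl bases shifts signs = done (same
    (λ z → cong-trans (cong-trans (≡⇒cong (sym (ℤ.+-identityʳ (base g z)))) (cong-+ˡ (base g z) (cong-sym (f≈0 z)))) (bases z))
    shifts signs)
  span⇒path {g = g} (cons {l} {f = f} c f′ i f≈) refl bases shifts signs = go l c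
    (span⇒path i (sym (state-gen l c g))
      (λ z → cong-trans (≡⇒cong (trans (cong (_+ f′ z) (base-gen l c g z)) (ℤ.+-assoc (base g z) _ _)))
        (cong-trans (cong-+ˡ (base g z) (cong-sym (f≈ z))) (bases z)))
      shifts signs)

  path-from-1 : ∀ h → Path k 1# h
  path-from-1 h = subst (λ n → Path n 1# h) length≡ (span⇒path (spanning⇒span spanning h) refl
    (λ z → ≡⇒cong (ℤ.+-identityˡ _))
    -- `Reach` fixes the position only after adding the offset, which is cancelled again here.
    (cong-trans (≡⇒cong (cancel _ (offset (sign h))))
      (cong-trans (cong-+ position (cong-refl {x = - offset (sign h)})) (≡⇒cong (sym (cancel (shift h) (offset (sign h)))))))
    direction)
    where
    open Reach (reach-all m q (sign h) (shift h + offset (sign h)))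
    cancel : ∀ x t → x ≡ (x + t) + - t
    cancel = solve-∀

  path : ∀ g h → Path k g h
  path g h = path-≈ (∙-identityʳ g)
    (≈-trans (≈-sym (∙-assoc g (g ⁻¹) h)) (≈-trans (∙-cong (∙-inverseʳ g) (≈-refl {h})) (∙-identityˡ h)))
    (path-∙ g (path-from-1 (g ⁻¹ ∙ h)))

-- The generating set and the diameter

module Cayley (q m : ℕ) .{{_ : NonZero q}} .{{_ : NonZero m}} {N : ℕ}
              (iso : Inverse (Group.setoid (Wreath.group (suc (q ℕ.+ q)) m)) (setoid (Fin N))) where

  open Paths q m
  open Spans k m
  open Wreath k m
  open Transport group iso
  open Inverse iso using (to; from; to-cong; strictlyInverseˡ)

  G : FiniteGroup N
  G = transport

  generators : Letter → List (Fin N)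
  generators l = tabulate (λ i → to (gen l (toℤ {m} i)))

  X : List (Fin N)
  X = generators a ++ generators b

  -- Paths use arbitrary integer labels, whereas `X` lists one representative of each class modulo
  -- `m`.
  gen∈X : ∀ l c → to (gen l c) ∈ X
  gen∈X l c = subst (_∈ X) (to-cong (gen-cong l (toℤ-residue {m} c))) (mem l)
    where
    mem : ∀ l → to (gen l (toℤ {m} (residue c))) ∈ X
    mem a = ∈-++⁺ˡ (∈-tabulate⁺ (residue c))
    mem b = ∈-++⁺ʳ (generators a) (∈-tabulate⁺ (residue c))

  path⇒walk : ∀ {n g h} → Path n g h → Walk G X n (to g) (to h)
  path⇒walk {g = g} {h} (done p) = subst (Walk G X 0 (to g)) (to-cong {g} {h} p) []
  path⇒walk {g = g} (go l c p) =
    (to (gen l c) , gen∈X l c , to-∙ g (gen l c)) ∷ path⇒walk p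

  diameter : DiameterLe G X k
  diameter u v = k , ℕ.≤-refl ,
    subst₂ (Walk G X k) (strictlyInverseˡ u) (strictlyInverseˡ v) (path⇒walk (path (from u) (from v)))

  1<k : 1 ℕ.< k
  1<k = ℕ.s≤s (ℕ.≤-trans (ℕ.>-nonZero⁻¹ q) (ℕ.m≤m+n q q))

  -- The value at 0 recovers the label, so distinct labels give distinct generators. For b this uses
  -- that 1 and 0 differ modulo `k`.
  gen-at-0 : ∀ l c → base (gen l c) (+ 0) ≡ c
  gen-at-0 a c = single-≡ (+ 0) c cong-refl
  gen-at-0 b c = trans
    (cong₂ _+_ (single-≡ (+ 0) c cong-refl) (single-off c 1<k ℕ.z<s (λ ())))
    (ℤ.+-identityʳ c)

  generators-unique : ∀ l → Unique (generators l)
  generators-unique l = Unique.tabulate⁺ λ {i} {j} eq → Fin.toℕ-injective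
    (residues-unique (Fin.toℕ<n i) (Fin.toℕ<n j)
      (subst₂ (Cong m) (gen-at-0 l (toℤ i)) (gen-at-0 l (toℤ j)) (base≈ (to-injective eq) (+ 0))))

  X-unique : Unique X
  X-unique = Unique.++⁺ (generators-unique a) (generators-unique b) disjoint
    where
    disjoint : ∀ {x} → ¬ (x ∈ generators a × x ∈ generators b)
    disjoint (p , q) with ∈-tabulate⁻ p | ∈-tabulate⁻ q
    -- An a-generator keeps the direction and a b-generator reverses it.
    ... | i , refl | j , eq with sign≡ (to-injective {gen a (toℤ i)} {gen b (toℤ j)} eq)
    ...   | ()

  -- An a moves the position by 2, which is nonzero modulo k > 2; a b changes the direction.
  gen≉1 : ∀ l c → ¬ 1# ≈ gen l c
  gen≉1 a c p with residues-unique {k} ℕ.z<s 2<k (shift≈ p)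
    where
    2<k : 2 ℕ.< k
    2<k = ℕ.s≤s (ℕ.+-mono-≤ (ℕ.>-nonZero⁻¹ q) (ℕ.>-nonZero⁻¹ q))
  ... | ()
  gen≉1 b c p with sign≡ p
  ... | ()

  1∉X : to 1# ∉ X
  1∉X p with ∈-++⁻ (generators a) p
  ... | inj₁ p′ = let i , eq = ∈-tabulate⁻ p′ in gen≉1 a (toℤ i) (to-injective eq)
  ... | inj₂ p′ = let i , eq = ∈-tabulate⁻ p′ in gen≉1 b (toℤ i) (to-injective eq)

  genSet : CayleyGenSet G X
  genSet = record
    { unique     = X-unique
    ; noIdentity = 1∉X
    ; generates  = λ g → walk⇒generated G (proj₂ (proj₂ (diameter (to 1#) g))) gen-e
    }

  degree : length X ≡ m ℕ.+ m
  degree = trans (length-++ (generators a)) (cong₂ ℕ._+_ (length-tabulate {n = m} _) (length-tabulate {n = m} _))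

n*2≡n+n : ∀ n → n ℕ.* 2 ≡ n ℕ.+ n
n*2≡n+n = ℕSolver.solve-∀

odd-half : ∀ k → k ℕ.% 2 ≡ 1 → k ≡ suc (k ℕ./ 2 ℕ.+ k ℕ./ 2)
odd-half k k%2≡1 = trans (ℕ.m≡m%n+[m/n]*n k 2) (cong₂ ℕ._+_ k%2≡1 (n*2≡n+n (k ℕ./ 2)))

even-half : ∀ d → d ℕ.% 2 ≡ 0 → d ≡ d ℕ./ 2 ℕ.+ d ℕ./ 2
even-half d d%2≡0 = trans (ℕ.m≡m%n+[m/n]*n d 2) (cong₂ ℕ._+_ d%2≡0 (n*2≡n+n (d ℕ./ 2)))

cayley : ∀ q d → .{{NonZero q}} → .{{NonZero (d ℕ./ 2)}} → d ℕ.% 2 ≡ 0 →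
  let k = suc (q ℕ.+ q) in
  Σ (FiniteGroup (2 ℕ.* k ℕ.* (d ℕ./ 2) ℕ.^ k)) λ G →
    Σ (List (Fin (2 ℕ.* k ℕ.* (d ℕ./ 2) ℕ.^ k))) λ X →
      CayleyGenSet G X × (length X ≡ d) × DiameterLe G X k
cayley q d d%2≡0 = G , X , genSet , trans degree (sym (even-half d d%2≡0)) , diameter
  where open Cayley q (d ℕ./ 2) (Encoding.encoding (suc (q ℕ.+ q)) (d ℕ./ 2))

theorem1 : (k d : ℕ) → k ℕ.% 2 ≡ 1 → 3 ℕ.≤ k → d ℕ.% 2 ≡ 0 → 2 ℕ.≤ d →
    Σ (FiniteGroup (2 ℕ.* k ℕ.* (d ℕ./ 2) ℕ.^ k)) λ G →
    Σ (List (Fin (2 ℕ.* k ℕ.* (d ℕ./ 2) ℕ.^ k))) λ X →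
    CayleyGenSet G X × (length X ≡ d) × DiameterLe G X k
theorem1 k d k-odd 3≤k d-even 2≤d = subst
  (λ k → Σ (FiniteGroup (2 ℕ.* k ℕ.* (d ℕ./ 2) ℕ.^ k)) λ G →
    Σ (List (Fin (2 ℕ.* k ℕ.* (d ℕ./ 2) ℕ.^ k))) λ X →
      CayleyGenSet G X × (length X ≡ d) × DiameterLe G X k)
  (sym (odd-half k k-odd))
  -- The bounds on `k` and `d` make q = k / 2 and m = d / 2 nonzero.
  (cayley (k ℕ./ 2) d {{ℕ.>-nonZero (ℕ.m≥n⇒m/n>0 (ℕ.<⇒≤ 3≤k))}} {{ℕ.>-nonZero (ℕ.m≥n⇒m/n>0 2≤d)}} d-even)
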